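{- Let $b$ be an odd integer with $3\le b\le 10^6$ and let $q$ be an odd prime with $q>\log_2(b+1)$. Then there are no integers $k, y\ge 2$ such that $$(2^{k}-1)(b^{k}-1)=y^{q},$$ except possibly when the pair $(b,q)$ is one of the following: (i) $q=5$ and $b\in\{15,17\}$; (ii) $q=11$ and $b\in\{1023,1025\}$; (iii) $q=13$ and $b\in\{4095,4097\}$; (iv) $q=17$ and $b=t\cdot 2^{14}+1$ or $b=t\cdot 2^{14}-1$ for some $t\in\{1,2,3,4,5,6,7\}$. -}

module Defs where

open import Data.Nat using (ℕ; _+_; _*_; _∸_; _^_; _≤_; _<_)
open import Data.Nat.Divisibility using (_∣_)
open import Data.Product using (_×_; ∃-syntax)
open import Data.Sum using (_⊎_)
open import Relation.Binary.PropositionalEquality using (_≡_)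
open import Relation.Nullary using (¬_)

Odd : ℕ → Set
Odd n = ¬ (2 ∣ n)

-- q > log₂ n for the real-valued logarithm of n ≥ 1: log₂ is the inverse of
-- the strictly increasing function x ↦ 2ˣ.
infix 4 _>log₂_

_>log₂_ : ℕ → ℕ → Set
q >log₂ n = n < 2 ^ q

-- No _∸_ below truncates when b ≥ 1: every minuend is then positive.
Solution : (b q k y : ℕ) → Set
Solution b q k y = (2 ^ k ∸ 1) * (b ^ k ∸ 1) ≡ y ^ q

Exceptional : (b q : ℕ) → Set
Exceptional b q =
    (q ≡ 5  × (b ≡ 15   ⊎ b ≡ 17))
  ⊎ (q ≡ 11 × (b ≡ 1023 ⊎ b ≡ 1025))
  ⊎ (q ≡ 13 × (b ≡ 4095 ⊎ b ≡ 4097))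
  ⊎ (q ≡ 17 × (∃[ t ] (1 ≤ t × t ≤ 7 ×
                        (b ≡ t * 2 ^ 14 + 1 ⊎ b ≡ t * 2 ^ 14 ∸ 1))))

-- Valuations at 2 first give 2 ∣ k. If r ≤ q is an odd prime with r ∸ 1 ∣ k, then lifting the exponent shows
-- that q divides v_r(2^(r-1) - 1) + v_r(b^(r-1) - 1) + 2 v_r(k) (without the second term, and with v_r(k)
-- once, when r ∣ b). Since the first two terms are small, k must be divisible by a large power of r. The
-- same works for r = 2 unless b ± 1 is divisible by a high power of 2, which is where the exceptional pairs
-- come from. For q ≥ 29 every n ≤ q divides k, by strong induction on n; for q < 29 one climbs
-- by hand to q ∸ 1 ∣ k and then to q ∣ k. But if k = q n, then with A = 2ⁿ and B = bⁿ the number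
-- (A^q - 1)(B^q - 1) lies too close to (A B)^q to be a q-th power.
--
-- A large value of v_r(b^(r-1) - 1) means that b is a small (r-1)-th root of unity modulo a high power of r.
-- For r < 1415 such roots are excluded by listing the powers of a generator; for r ≥ 1415 the two valuations
-- add up to at most r ∸ 1 because r² ≥ 2b and r divides only one of x^((r-1)/2) ± 1.
{-# OPTIONS --safe #-}
module Submission where

open import Data.Nat
open import Data.Nat.Properties
open import Data.Nat.Divisibility
open import Data.Nat.Induction using (<-rec)
open import Data.Nat.Primality
  using (Prime; euclidsLemma; prime⇒nonZero; prime⇒nonTrivial; ¬prime[0]; prime⇒irreducible;
    prime[2]; prime?)
open import Data.Nat.Tactic.RingSolver using (solve-∀)
open import Data.Product using (_×_; _,_; proj₁; proj₂; ∃-syntax)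
open import Data.Sum using (_⊎_; inj₁; inj₂; [_,_]′)
open import Data.Empty using (⊥; ⊥-elim)
open import Relation.Nullary using (¬_; yes; no; Dec)
open import Relation.Binary.PropositionalEquality
open import Data.Nat.Combinatorics using (_C_; nCn≡1; nCk+nC[k+1]≡[n+1]C[k+1])
open import Data.Nat.Combinatorics.Specification using (k>n⇒nCk≡0)
open import Data.Nat.DivMod
open import Data.Bool using (Bool; true; false; _∧_; if_then_else_; T; _∨_)
open import Data.Fin using (Fin; zero; suc; toℕ; fromℕ<)
open import Data.Fin.Properties using (pigeonhole; toℕ-fromℕ<; toℕ<n)
open import Data.Bool.ListAction using (any; all)
open import Data.List using (List; []; _∷_; applyUpTo)
open import Data.Unit using (tt)
open import Data.List.Relation.Unary.All using (_∷_)
open import Data.Nat.Primality.Factorisation using (factorise)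
open import Relation.Nullary.Decidable using (from-yes; from-no; _⊎-dec_; _→-dec_)
open import Defs
import Data.Bool.Properties as Bool
open import Data.List.Membership.Propositional using (_∈_)
open import Data.List.Membership.DecPropositional _≟_ using (_∈?_)
open import Data.List.Relation.Unary.Any using (here; there)

-- Valuations at a prime.

record Val (p n e : ℕ) : Set where
  constructor val
  field
    cofactor   : ℕ
    factored   : n ≡ p ^ e * cofactor
    p∤cofactor : ¬ p ∣ cofactor

prime>1 : ∀ {p} → Prime p → 2 ≤ p
prime>1 pr = nonTrivial⇒n>1 _ {{prime⇒nonTrivial pr}}

prime∤1 : ∀ {p} → Prime p → ¬ p ∣ 1
prime∤1 pr p∣1 = <⇒≢ (prime>1 pr) (sym (∣1⇒≡1 p∣1))

prime∤* : ∀ {p m n} → Prime p → ¬ p ∣ m → ¬ p ∣ n → ¬ p ∣ m * n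
prime∤* {m = m} {n} pr p∤m p∤n p∣mn = [ p∤m , p∤n ]′ (euclidsLemma m n pr p∣mn)

prime∤^ : ∀ {p m} n → Prime p → ¬ p ∣ m → ¬ p ∣ m ^ n
prime∤^ zero    pr p∤m = prime∤1 pr
prime∤^ (suc n) pr p∤m = prime∤* pr p∤m (prime∤^ n pr p∤m)

^-monoʳ-∣ : ∀ p {e f} → e ≤ f → p ^ e ∣ p ^ f
^-monoʳ-∣ p {e} {f} e≤f = subst (p ^ e ∣_)
  (trans (sym (^-distribˡ-+-* p e (f ∸ e))) (cong (p ^_) (m+[n∸m]≡n e≤f)))
  (m∣m*n (p ^ (f ∸ e)))

val-∣ : ∀ {p n e f} → Val p n e → f ≤ e → p ^ f ∣ n
val-∣ {p} (val u refl _) f≤e = ∣-trans (^-monoʳ-∣ p f≤e) (m∣m*n u)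

val-max : ∀ {p n e f} → Prime p → Val p n e → p ^ f ∣ n → f ≤ e
val-max {p} {n} {e} {f} pr (val u refl p∤u) p^f∣n = ≮⇒≥ λ e<f → p∤u
  (*-cancelˡ-∣ (p ^ e) {{m^n≢0 p e {{prime⇒nonZero pr}}}}
    (subst (_∣ p ^ e * u) (*-comm p (p ^ e)) (∣-trans (^-monoʳ-∣ p e<f) p^f∣n)))

val-unique : ∀ {p n e f} → Prime p → Val p n e → Val p n f → e ≡ f
val-unique pr v w = ≤-antisym (val-max pr w (val-∣ v ≤-refl)) (val-max pr v (val-∣ w ≤-refl))

val-* : ∀ {p m n e f} → Prime p → Val p m e → Val p n f → Val p (m * n) (e + f)
val-* {p} {e = e} {f} pr (val u refl p∤u) (val w refl p∤w) =
  val (u * w)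
    (trans (lem (p ^ e) u (p ^ f) w) (cong (_* (u * w)) (sym (^-distribˡ-+-* p e f))))
    (prime∤* pr p∤u p∤w)
  where
  lem : ∀ a b c d → a * b * (c * d) ≡ a * c * (b * d)
  lem = solve-∀

val-0 : ∀ {p n} → ¬ p ∣ n → Val p n 0
val-0 {n = n} p∤n = val n (sym (*-identityˡ n)) p∤n

val-^ : ∀ {p n e} → Prime p → ∀ k → Val p n e → Val p (n ^ k) (k * e)
val-^ pr zero    v = val-0 (prime∤1 pr)
val-^ pr (suc k) v = val-* pr v (val-^ pr k v)

val-exists : ∀ {p} → Prime p → ∀ n → 1 ≤ n → ∃[ e ] Val p n e
val-exists {p} pr = <-rec _ step
  where
  step : ∀ n → (∀ {m} → m < n → 1 ≤ m → ∃[ e ] Val p m e) → 1 ≤ n → ∃[ e ] Val p n e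
  step n rec 1≤n with p ∣? n
  ... | no p∤n = 0 , val-0 p∤n
  ... | yes (divides zero refl) = ⊥-elim (<-irrefl refl 1≤n)
  ... | yes (divides m@(suc _) refl) with rec (m<m*n m p (prime>1 pr)) (s≤s z≤n)
  ...   | e , val u m≡ p∤u = suc e , val u
          (trans (cong (_* p) m≡) (trans (*-comm (p ^ e * u) p) (sym (*-assoc p (p ^ e) u)))) p∤u

^-coprime-cancel-∣ : ∀ {p} e {u c} → Prime p → ¬ p ∣ u → p ^ e ∣ u * c → p ^ e ∣ c
^-coprime-cancel-∣ zero    {c = c} pr p∤u _ = 1∣ c
^-coprime-cancel-∣ {p} (suc e) {u} {c} pr p∤u d with euclidsLemma u c pr (∣-trans (m∣m*n (p ^ e)) d)
... | inj₁ p∣u = ⊥-elim (p∤u p∣u)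
... | inj₂ (divides c′ refl) = subst (p ^ suc e ∣_) (*-comm p c′) (*-monoʳ-∣ p
        (^-coprime-cancel-∣ e pr p∤u
          (*-cancelˡ-∣ p {{prime⇒nonZero pr}} (subst (p * p ^ e ∣_) (lem u c′ p) d))))
  where
  lem : ∀ u c p → u * (c * p) ≡ p * (u * c)
  lem = solve-∀

val-power : ∀ {p y q e} → Prime p → 1 ≤ y → Val p (y ^ q) e → q ∣ e
val-power {p} {y} {q} pr 1≤y v with val-exists pr y 1≤y
... | f , w = subst (q ∣_) (val-unique pr (val-^ pr q w) v) (m∣m*n f)

-- Lifting the exponent.

triangle : ℕ → ℕ
triangle zero    = 0
triangle (suc n) = n + triangle n

triangle-double : ∀ n → triangle n * 2 + n ≡ n * n
triangle-double zero    = refl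
triangle-double (suc n) = trans (lem n (triangle n))
  (trans (cong (λ s → s + n + (1 + n)) (triangle-double n)) (lem′ n))
  where
  lem : ∀ n t → (n + t) * 2 + suc n ≡ (t * 2 + n) + n + (1 + n)
  lem = solve-∀
  lem′ : ∀ n → n * n + n + (1 + n) ≡ suc n * suc n
  lem′ = solve-∀

prime∣triangle : ∀ {p} → Prime p → ¬ p ∣ 2 → p ∣ triangle p
prime∣triangle {p} pr p∤2 with euclidsLemma (triangle p) 2 pr
  (∣m+n∣n⇒∣m (subst (p ∣_) (sym (triangle-double p)) (m∣m*n p)) ∣-refl)
  where
  ∣m+n∣n⇒∣m : ∀ {m n} → p ∣ m + n → p ∣ n → p ∣ m
  ∣m+n∣n⇒∣m {m} {n} d e = ∣m+n∣m⇒∣n (subst (p ∣_) (+-comm m n) d) e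
... | inj₁ d = d
... | inj₂ d = ⊥-elim (p∤2 d)

-- This is the binomial expansion of (1 + z)^n: `triangle n` is the coefficient n(n-1)/2, and c
-- collects everything from the third order on.
expand : ∀ z n → ∃[ c ] suc z ^ n ≡ 1 + z * (n + (triangle n * z + z * z * c))
expand z zero    = 0 , lem z
  where
  lem : ∀ z → 1 ≡ 1 + z * (0 + (0 * z + z * z * 0))
  lem = solve-∀
expand z (suc n) with expand z n
... | c , eq = triangle n + c + z * c , trans (cong (suc z *_) eq) (lem z n (triangle n) c)
  where
  lem : ∀ z n t c → (1 + z) * (1 + z * (n + (t * z + z * z * c)))
                  ≡ 1 + z * (1 + n + ((n + t) * z + z * z * (t + c + z * c)))
  lem = solve-∀

-- The second condition makes the quadratic term of `expand` at n = p, divided by z, a multiple of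
-- p². For odd p it follows from the first, since p divides `triangle p`; for p = 2 it says 4 ∣ z.
Liftable : (p z : ℕ) → Set
Liftable p z = p ∣ z × p * p ∣ triangle p * z

liftable-∣ : ∀ {p y z} → Liftable p y → y ∣ z → Liftable p z
liftable-∣ {p} (d , e) y∣z = ∣-trans d y∣z , ∣-trans e (*-monoʳ-∣ (triangle p) y∣z)

odd-liftable : ∀ {p z} → Prime p → ¬ p ∣ 2 → p ∣ z → Liftable p z
odd-liftable {p} {z} pr p∤2 p∣z = p∣z , *-pres-∣ (prime∣triangle pr p∤2) p∣z

∣m∧∤n⇒∤n+m : ∀ {p m n} → p ∣ m → ¬ p ∣ n → ¬ p ∣ n + m
∣m∧∤n⇒∤n+m {p} {m} {n} p∣m p∤n d = p∤n (∣m+n∣m⇒∣n (subst (p ∣_) (+-comm n m) d) p∣m)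

-- In (1 + z)^n - 1 = z w the cofactor w is congruent to n modulo p, hence prime to p.
val-coprime-power : ∀ {p z e n} → Prime p → p ∣ z → ¬ p ∣ n →
  Val p z e → Val p (suc z ^ n ∸ 1) e
val-coprime-power {p} {z} {e} {n} pr p∣z p∤n (val u z≡ p∤u) with expand z n
... | c , eq = val (u * w) (trans (cong (_∸ 1) eq) (trans (cong (_* w) z≡) (*-assoc (p ^ e) u w)))
      (prime∤* pr p∤u (∣m∧∤n⇒∤n+m (∣m∣n⇒∣m+n (∣n⇒∣m*n (triangle n) p∣z)
        (∣m⇒∣m*n c (∣m⇒∣m*n z p∣z))) p∤n))
  where w = n + (triangle n * z + z * z * c)

-- (1 + z)^p - 1 is z times p(1 + dp), so exactly one factor p is gained. Since z ∣ z′, `Liftable`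
-- passes to z′ and the step can be repeated.
val-prime-power : ∀ {p z e} → Prime p → Liftable p z → Val p z e →
  ∃[ z′ ] (suc z ^ p ≡ suc z′ × z ∣ z′ × Val p z′ (e + 1))
val-prime-power {p} {z} {e} pr (p∣z , pp∣Tz) (val u z≡ p∤u) with expand z p
... | c , eq with ∣m∣n⇒∣m+n pp∣Tz (∣m⇒∣m*n c (*-pres-∣ p∣z p∣z))
...   | divides d r = z * (p + (triangle p * z + z * z * c)) , eq , m∣m*n _ ,
        val (u * (1 + d * p))
          (trans (cong₂ (λ a b → a * (p + b)) z≡ r)
            (trans (lem (p ^ e) u p d) (cong (_* (u * (1 + d * p))) (sym (^-distribˡ-+-* p e 1)))))
          (prime∤* pr p∤u (∣m∧∤n⇒∤n+m (n∣m*n d) (prime∤1 pr)))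
  where
  lem : ∀ P u p d → P * u * (p + d * (p * p)) ≡ P * (p * 1) * (u * (1 + d * p))
  lem = solve-∀

-- With n = p^v w, the base is replaced by its p-th power v times, each time gaining 1 in the
-- valuation; the exponent w prime to p comes last.
lifting-the-exponent : ∀ {p z e n v} → Prime p → Liftable p z →
  Val p z e → Val p n v → Val p (suc z ^ n ∸ 1) (e + v)
lifting-the-exponent {p} {z} {e} pr l vz (val w refl p∤w) = go _ l vz
  where
  go : ∀ v {z e} → Liftable p z → Val p z e → Val p (suc z ^ (p ^ v * w) ∸ 1) (e + v)
  go zero    {z} {e} l vz = subst₂ (λ n f → Val p (suc z ^ n ∸ 1) f) (sym (*-identityˡ w))
    (sym (+-identityʳ e)) (val-coprime-power pr (proj₁ l) p∤w vz)
  go (suc v) {z} {e} l vz with val-prime-power pr l vz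
  ... | z′ , eq , z∣z′ , vz′ = subst₂ (λ x f → Val p (x ∸ 1) f)
        (trans (cong (_^ (p ^ v * w)) (sym eq))
          (trans (^-*-assoc (suc z) p (p ^ v * w)) (cong (suc z ^_) (sym (*-assoc p (p ^ v) w)))))
        (+-assoc e 1 v) (go v (liftable-∣ l z∣z′) vz′)

-- Fermat's little theorem.

absorption : ∀ n k → suc k * (suc n C suc k) ≡ suc n * (n C k)
absorption zero    zero    = refl
absorption zero    (suc k) = trans
  (cong (suc (suc k) *_) (k>n⇒nCk≡0 {1} {suc (suc k)} (s≤s (s≤s z≤n))))
  (trans (*-zeroʳ (suc (suc k))) (sym (cong (1 *_) (k>n⇒nCk≡0 {0} {suc k} (s≤s z≤n)))))
absorption (suc n) zero    = begin
  1 * (suc (suc n) C 1)           ≡⟨ cong (1 *_) (nCk+nC[k+1]≡[n+1]C[k+1] (suc n) 0) ⟨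
  1 * (1 + (suc n C 1))           ≡⟨ *-identityˡ (1 + (suc n C 1)) ⟩
  1 + (suc n C 1)                 ≡⟨ cong (1 +_) (trans (sym (*-identityˡ (suc n C 1))) (absorption n 0)) ⟩
  1 + suc n * 1                   ≡⟨⟩
  suc (suc n) * 1                 ∎
  where open ≡-Reasoning
absorption (suc n) (suc k) = begin
  suc (suc k) * (suc (suc n) C suc (suc k))
    ≡⟨ cong (suc (suc k) *_) (nCk+nC[k+1]≡[n+1]C[k+1] (suc n) (suc k)) ⟨
  suc (suc k) * (x + y)
    ≡⟨ split k x y ⟩
  x + suc k * x + suc (suc k) * y
    ≡⟨ cong₂ (λ s t → x + s + t) (absorption n k) (absorption n (suc k)) ⟩
  x + suc n * (n C k) + suc n * (n C suc k)
    ≡⟨ regroup x n (n C k) (n C suc k) ⟩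
  x + suc n * ((n C k) + (n C suc k))
    ≡⟨ cong (λ s → x + suc n * s) (nCk+nC[k+1]≡[n+1]C[k+1] n k) ⟩
  suc (suc n) * x ∎
  where
  open ≡-Reasoning
  x = suc n C suc k
  y = suc n C suc (suc k)
  split : ∀ k x y → suc (suc k) * (x + y) ≡ x + suc k * x + suc (suc k) * y
  split = solve-∀
  regroup : ∀ x n a b → x + suc n * a + suc n * b ≡ x + suc n * (a + b)
  regroup = solve-∀

-- By `absorption`, p divides k + 1 times this coefficient, and p cannot divide k + 1 < p.
prime∣C : ∀ {p} → Prime p → ∀ k → suc k < p → p ∣ p C suc k
prime∣C {suc n} pr k k<p with euclidsLemma (suc k) (suc n C suc k) pr
  (divides (n C k) (trans (absorption n k) (*-comm (suc n) (n C k))))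
... | inj₁ d = ⊥-elim (>⇒∤ k<p d)
... | inj₂ d = d

-- Truncation to m terms lets both Pascal's rule and the reduction modulo p run by induction on m;
-- `fermat` then splits off the top term a^p.
partialBinomial : (n a m : ℕ) → ℕ
partialBinomial n a zero    = 0
partialBinomial n a (suc m) = partialBinomial n a m + (n C m) * a ^ m

partialBinomial-suc : ∀ n a m →
  partialBinomial (suc n) a (suc m) ≡ partialBinomial n a (suc m) + a * partialBinomial n a m
partialBinomial-suc n a zero    = cong (1 +_) (sym (*-zeroʳ a))
partialBinomial-suc n a (suc m) = trans
  (cong₂ (λ s c → s + c * a ^ suc m) (partialBinomial-suc n a m) (sym (nCk+nC[k+1]≡[n+1]C[k+1] n m)))
  (lem (partialBinomial n a m) (n C m) (n C suc m) a (a ^ m))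
  where
  lem : ∀ s c d a x → s + c * x + a * s + (c + d) * (a * x)
                    ≡ s + c * x + d * (a * x) + a * (s + c * x)
  lem = solve-∀

binomial : ∀ n a → suc a ^ n ≡ partialBinomial n a (suc n)
binomial zero    a = refl
binomial (suc n) a = sym (trans (partialBinomial-suc n a (suc n))
  (trans (cong (_+ a * s) (trans (cong (λ c → s + c * a ^ suc n) (k>n⇒nCk≡0 (n<1+n n))) (+-identityʳ s)))
    (cong (suc a *_) (sym (binomial n a)))))
  where s = partialBinomial n a (suc n)

partialBinomial-mod : ∀ {p} → Prime p → ∀ a m → m < p → ∃[ c ] partialBinomial p a (suc m) ≡ 1 + c * p
partialBinomial-mod pr a zero    _   = 0 , refl
partialBinomial-mod {p} pr a (suc m) m<p with partialBinomial-mod pr a m (<-trans (n<1+n m) m<p) | prime∣C pr m m<p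
... | c , eq | divides d eq′ = c + d * a ^ suc m ,
  trans (cong₂ (λ s t → s + t * a ^ suc m) eq eq′) (lem c d p (a ^ suc m))
  where
  lem : ∀ c d p x → 1 + c * p + d * p * x ≡ 1 + (c + d * x) * p
  lem = solve-∀

fermat : ∀ {p} → Prime p → ∀ a → ∃[ c ] a ^ p ≡ a + c * p
fermat {suc n} pr zero    = 0 , refl
fermat {suc n} pr (suc a) with partialBinomial-mod pr a n (n<1+n n) | fermat pr a
... | c , eq | d , eq′ = c + d ,
  trans (binomial (suc n) a) (trans (cong₂ (λ s t → s + t) eq
    (trans (cong (_* a ^ suc n) (nCn≡1 (suc n))) (trans (*-identityˡ (a ^ suc n)) eq′)))
    (lem c d a (suc n)))
  where
  lem : ∀ c d a p → 1 + c * p + (a + d * p) ≡ suc a + (c + d) * p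
  lem = solve-∀

fermat-∣ : ∀ {p a} → Prime p → ¬ p ∣ a → p ∣ a ^ (p ∸ 1) ∸ 1
fermat-∣ {suc n} {a} pr p∤a with fermat pr a
... | c , eq with euclidsLemma a (a ^ n ∸ 1) pr (divides c
      (trans (*-distribˡ-∸ a (a ^ n) 1)
        (trans (cong₂ _∸_ eq (*-identityʳ a)) (m+n∸m≡n a (c * suc n)))))
...   | inj₁ p∣a = ⊥-elim (p∤a p∣a)
...   | inj₂ d   = d

-- Congruences and roots of unity modulo prime powers.

record Cong (N x y : ℕ) : Set where
  constructor shift
  field
    a b     : ℕ
    shifted : x + a * N ≡ y + b * N

Cong-sym : ∀ {N x y} → Cong N x y → Cong N y x
Cong-sym (shift a b eq) = shift b a (sym eq)

Cong-trans : ∀ {N x y z} → Cong N x y → Cong N y z → Cong N x z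
Cong-trans {N} {x} {y} {z} (shift a b eq) (shift c d eq′) = shift (a + c) (d + b)
  (trans (lem x a c N) (trans (cong (_+ c * N) eq) (trans (swap y b c N)
    (trans (cong (_+ b * N) eq′) (sym (lem z d b N))))))
  where
  lem : ∀ x a c N → x + (a + c) * N ≡ x + a * N + c * N
  lem = solve-∀
  swap : ∀ y b c N → y + b * N + c * N ≡ y + c * N + b * N
  swap = solve-∀

Cong-reflexive : ∀ {N x y} → x ≡ y → Cong N x y
Cong-reflexive eq = shift 0 0 (cong (_+ 0) eq)

Cong-* : ∀ {N x y x′ y′} → Cong N x y → Cong N x′ y′ → Cong N (x * x′) (y * y′)
Cong-* {N} {x} {y} {x′} {y′} (shift a b eq) (shift c d eq′) =
  shift (x * c + a * x′ + a * c * N) (y * d + b * y′ + b * d * N)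
    (trans (lem x a x′ c N) (trans (cong₂ _*_ eq eq′) (sym (lem y b y′ d N))))
  where
  lem : ∀ x a x′ c N → x * x′ + (x * c + a * x′ + a * c * N) * N ≡ (x + a * N) * (x′ + c * N)
  lem = solve-∀

Cong-∣ : ∀ {M N x y} → M ∣ N → Cong N x y → Cong M x y
Cong-∣ {M} {x = x} {y} (divides k refl) (shift a b eq) = shift (a * k) (b * k)
  (trans (cong (x +_) (*-assoc a k M)) (trans eq (cong (y +_) (sym (*-assoc b k M)))))

Cong-% : ∀ N .{{_ : NonZero N}} x → Cong N (x % N) x
Cong-% N x = shift (x / N) 0 (trans (sym (m≡m%n+[m/n]*n x N)) (sym (+-identityʳ x)))

Cong-unique : ∀ {N x y} → x < N → y < N → Cong N x y → x ≡ y
Cong-unique {N@(suc _)} {x} {y} x<N y<N (shift a b eq) = begin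
  x               ≡⟨ m<n⇒m%n≡m x<N ⟨
  x % N           ≡⟨ [m+kn]%n≡m%n x a N ⟨
  (x + a * N) % N ≡⟨ cong (_% N) eq ⟩
  (y + b * N) % N ≡⟨ [m+kn]%n≡m%n y b N ⟩
  y % N           ≡⟨ m<n⇒m%n≡m y<N ⟩
  y               ∎
  where open ≡-Reasoning

power-expand : ∀ x w n → ∃[ c ] (x + w) ^ suc n ≡ x ^ suc n + (suc n * w * x ^ n + w * w * c)
power-expand x w zero    = 0 , lem x w
  where
  lem : ∀ x w → (x + w) * 1 ≡ x * 1 + (1 * w * 1 + w * w * 0)
  lem = solve-∀
power-expand x w (suc n) with power-expand x w n
... | c , eq = x * c + suc n * x ^ n + w * c , trans (cong ((x + w) *_) eq) (lem x w n (x ^ n) c)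
  where
  lem : ∀ x w n X c → (x + w) * (x * X + (suc n * w * X + w * w * c))
      ≡ x * (x * X) + (suc (suc n) * w * (x * X) + w * w * (x * c + suc n * X + w * c))
  lem = solve-∀

-- In the expansion of (x + aP)^p the linear term carries the factor pP and the higher ones carry
-- P², a multiple of pP because p ∣ P.
Cong-power : ∀ {p P x y} .{{_ : NonZero p}} → p ∣ P → Cong P x y → Cong (p * P) (x ^ p) (y ^ p)
Cong-power {p@(suc n)} {P} {x} {y} (divides k P≡) (shift a b eq) =
  Cong-trans (Cong-sym (perturb x a)) (Cong-trans (Cong-reflexive (cong (_^ p) eq)) (perturb y b))
  where
  perturb : ∀ x a → Cong (p * P) ((x + a * P) ^ p) (x ^ p)
  perturb x a with power-expand x (a * P) n
  ... | c , eq = shift 0 (a * x ^ n + a * (k * a) * c)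
    (trans (+-identityʳ _) (trans eq (cong (x ^ p +_) (trans
      (cong (λ Q → p * (a * P) * x ^ n + a * P * (a * Q) * c) P≡) (lem p a P (x ^ n) k c)))))
    where
    lem : ∀ p a P X k c → p * (a * P) * X + a * P * (a * (k * p)) * c
                        ≡ (a * X + a * (k * a) * c) * (p * P)
    lem = solve-∀

Root : (p N x : ℕ) → Set
Root p N x = Cong N (x ^ (p ∸ 1)) 1

-- If x ≡ y (mod pⁱ) then x ≡ xᵖ ≡ yᵖ ≡ y (mod pⁱ⁺¹).
root-rigid : ∀ {p x y} .{{_ : NonZero p}} m → Root p (p ^ suc m) x → Root p (p ^ suc m) y →
  Cong p x y → Cong (p ^ suc m) x y
root-rigid {p}           zero    _  _  x≡y = subst (λ N → Cong N _ _) (sym (*-identityʳ p)) x≡y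
root-rigid {p@(suc n)} {x} {y} (suc m) rx ry x≡y =
  Cong-trans (Cong-sym (p-th-power x rx)) (Cong-trans (Cong-power (m∣m*n (p ^ m))
    (root-rigid m (Cong-∣ (n∣m*n p) rx) (Cong-∣ (n∣m*n p) ry) x≡y)) (p-th-power y ry))
  where
  p-th-power : ∀ x → Root p (p ^ suc (suc m)) x → Cong (p ^ suc (suc m)) (x ^ p) x
  p-th-power x rx = Cong-trans (Cong-* (Cong-reflexive {x = x} refl) rx) (Cong-reflexive (*-identityʳ x))

root-∤ : ∀ {p x} m → Prime p → Root p (p ^ suc m) x → ¬ p ∣ x
root-∤ {zero}        m pr r p∣x = ⊥-elim (¬prime[0] pr)
root-∤ {suc zero}    m pr r p∣x = prime∤1 pr ∣-refl
root-∤ {p@(suc (suc n))} {x} m pr r p∣x with Cong-∣ {p} (m∣m*n (p ^ m)) r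
... | shift a b eq = prime∤1 pr (∣m+n∣m⇒∣n
        (subst (p ∣_) (trans eq (+-comm 1 (b * p))) (∣m∣n⇒∣m+n (∣m⇒∣m*n (x ^ n) p∣x) (n∣m*n a)))
        (n∣m*n b))

-- The p numbers have only p - 1 nonzero residues to share.
prime-pigeonhole : ∀ {p} → Prime p → (u : Fin p → ℕ) → (∀ i → ¬ p ∣ u i) →
  ∃[ i ] ∃[ j ] (toℕ i < toℕ j × Cong p (u i) (u j))
prime-pigeonhole {zero} pr u _ = ⊥-elim (¬prime[0] pr)
prime-pigeonhole {p@(suc n)} pr u p∤u = collision (pigeonhole (n<1+n n) index)
  where
  residue≢0 : ∀ i → NonZero (u i % p)
  residue≢0 i = ≢-nonZero λ eq → p∤u i (m%n≡0⇒n∣m (u i) p eq)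
  -- Nonzero residues are shifted down by one, so that they fit into `Fin n` with n = p - 1.
  bound : ∀ i → pred (u i % p) < n
  bound i = ≤-trans (≤-reflexive (suc-pred (u i % p) {{residue≢0 i}})) (<⇒≤pred (m%n<n (u i) p))
  index : Fin p → Fin n
  index i = fromℕ< (bound i)
  residue : ∀ i → u i % p ≡ suc (toℕ (index i))
  residue i = trans (sym (suc-pred (u i % p) {{residue≢0 i}})) (cong suc (sym (toℕ-fromℕ< (bound i))))
  collision : (∃[ i ] ∃[ j ] (toℕ i < toℕ j × index i ≡ index j)) →
    ∃[ i ] ∃[ j ] (toℕ i < toℕ j × Cong p (u i) (u j))
  collision (i , j , i<j , eq) = i , j , i<j ,
    Cong-trans (Cong-sym (Cong-% p (u i))) (Cong-trans (Cong-reflexive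
      (trans (residue i) (trans (cong (λ k → suc (toℕ k)) eq) (sym (residue j))))) (Cong-% p (u j)))

-- A collision modulo p persists modulo p^(m+1) by `root-rigid`; so there are at most p - 1 roots,
-- as over a field.
root-pigeonhole : ∀ {p} m → Prime p → (u : Fin p → ℕ) → (∀ i → Root p (p ^ suc m) (u i)) →
  ∃[ i ] ∃[ j ] (toℕ i < toℕ j × Cong (p ^ suc m) (u i) (u j))
root-pigeonhole m pr u root with prime-pigeonhole pr u (λ i → root-∤ m pr (root i))
... | i , j , i<j , u≡ = i , j , i<j , root-rigid {{prime⇒nonZero pr}} m (root i) (root j) u≡

-- Certifying by computation that all roots other than 1 are large.

powMod : (N : ℕ) .{{_ : NonZero N}} (fuel b e : ℕ) → ℕ
powMod N zero    b e         = 1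
powMod N (suc f) b 0         = 1
powMod N (suc f) b e@(suc _) =
  if e % 2 ≡ᵇ 0 then powMod N f (b * b % N) (e / 2)
  else b * powMod N f (b * b % N) (e / 2) % N

-- The walk x, xω, xω², ... starts at x = ω in use. Its final test for 1 certifies that ω is a root
-- of unity, however ω was computed.
powersExceed : (N : ℕ) .{{_ : NonZero N}} (X ω n x : ℕ) → Bool
powersExceed N X ω zero    x = x ≡ᵇ 1
powersExceed N X ω (suc n) x = (X <ᵇ x) ∧ powersExceed N X ω n (x * ω % N)

largeRootsMod : (N X n g e : ℕ) → Bool
largeRootsMod zero      X n g e = false
largeRootsMod N@(suc _) X n g e = powersExceed N X (ω % N) n (ω % N)
  where
  ω : ℕ
  ω = powMod N 200 g e

-- g should be a primitive root modulo p: then g^(p^(m-1)) generates the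
-- (p-1)-th roots of unity modulo pᵐ. The fuel 200 exceeds the number of binary
-- digits of every exponent p^(m-1) used; soundness does not depend on it.
largeRoots : (X m p g : ℕ) → Bool
largeRoots X m p g = largeRootsMod (p ^ m) X (p ∸ 2) g (p ^ (m ∸ 1))

∧-true : ∀ {a b} → a ∧ b ≡ true → a ≡ true × b ≡ true
∧-true {true} eq = refl , eq

≡ᵇ-true : ∀ {m n} → (m ≡ᵇ n) ≡ true → m ≡ n
≡ᵇ-true {m} {n} eq = ≡ᵇ⇒≡ m n (subst T (sym eq) tt)

<ᵇ-true : ∀ {m n} → (m <ᵇ n) ≡ true → m < n
<ᵇ-true {m} {n} eq = <ᵇ⇒< m n (subst T (sym eq) tt)

HasLargeResidue : (N X y : ℕ) → Set
HasLargeResidue N X y = ∃[ v ] (v < N × X < v × Cong N v y)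

powersExceed-sound : ∀ N .{{_ : NonZero N}} X ω n x → x < N → powersExceed N X ω n x ≡ true →
  (∀ {i} → i < n → HasLargeResidue N X (x * ω ^ i)) × Cong N (x * ω ^ n) 1
powersExceed-sound N X ω zero    x x<N eq =
  (λ ()) , Cong-reflexive (trans (*-identityʳ x) (≡ᵇ-true eq))
powersExceed-sound N X ω (suc n) x x<N eq with ∧-true eq
... | X<x , eq′ with powersExceed-sound N X ω n (x * ω % N) (m%n<n (x * ω) N) eq′
...   | large , root = large′ , Cong-trans (Cong-sym (next n)) root
  where
  next : ∀ i → Cong N (x * ω % N * ω ^ i) (x * ω ^ suc i)
  next i = Cong-trans (Cong-* (Cong-% N (x * ω)) (Cong-reflexive {x = ω ^ i} refl))
    (Cong-reflexive (*-assoc x ω (ω ^ i)))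
  large′ : ∀ {i} → i < suc n → HasLargeResidue N X (x * ω ^ i)
  large′ {zero}  _         = x , x<N , <ᵇ-true X<x , Cong-reflexive (sym (*-identityʳ x))
  large′ {suc i} (s≤s i<n) with large i<n
  ... | v , v<N , X<v , v≡ = v , v<N , X<v , Cong-trans v≡ (next i)

largeRootsMod-sound : ∀ {N X n g e} → largeRootsMod N X n g e ≡ true →
  ∃[ ω ] ((∀ {i} → i < n → HasLargeResidue N X (ω ^ suc i)) × Cong N (ω ^ suc n) 1)
largeRootsMod-sound {N@(suc _)} {X} {n} {g} {e} eq =
  ω , powersExceed-sound N X ω n ω (m%n<n (powMod N 200 g e) N) eq
  where
  ω : ℕ
  ω = powMod N 200 g e % N

-- Multiplying the congruence by ω^(n+1-i) completes ω^i to ω^(n+1), which is 1; this cancels ω^i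
-- without an inverse.
Cong-^-shift : ∀ {N ω n i} d → Cong N (ω ^ suc n) 1 → i ≤ suc n → Cong N (ω ^ i) (ω ^ (i + d)) →
  Cong N (ω ^ d) 1
Cong-^-shift {N} {ω} {n} {i} d ω^≡1 i≤n ω^i≡ =
  Cong-trans (Cong-sym (Cong-trans (Cong-* (Cong-reflexive {x = ω ^ d} refl) ω^≡1)
    (Cong-reflexive (*-identityʳ (ω ^ d)))))
  (Cong-trans (Cong-reflexive (trans (sym (^-distribˡ-+-* ω d (suc n))) (trans (cong (ω ^_) exponents)
    (^-distribˡ-+-* ω (i + d) k))))
  (Cong-trans (Cong-* (Cong-sym ω^i≡) (Cong-reflexive {x = ω ^ k} refl))
  (Cong-trans (Cong-reflexive (trans (sym (^-distribˡ-+-* ω i k)) (cong (ω ^_) i+k≡))) ω^≡1)))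
  where
  k = suc n ∸ i
  i+k≡ : i + k ≡ suc n
  i+k≡ = m+[n∸m]≡n i≤n
  exponents : d + suc n ≡ i + d + k
  exponents = trans (cong (d +_) (sym i+k≡)) (lem d i k)
    where
    lem : ∀ d i k → d + (i + k) ≡ i + d + k
    lem = solve-∀

∣∸1⇒Cong : ∀ {N y} → 1 ≤ y → N ∣ y ∸ 1 → Cong N y 1
∣∸1⇒Cong {N} {y} 1≤y (divides c y∸1≡) = shift 0 c
  (trans (+-identityʳ y) (trans (sym (m+[n∸m]≡n 1≤y)) (cong (1 +_) y∸1≡)))

-- A root b ≤ X and the p ∸ 1 powers of ω are p roots, so two of them agree
-- modulo pᵐ: then b is a power of ω, or two powers of ω agree.
largeRoots-sound : ∀ X m p g → Prime p → 3 ≤ p → largeRoots X (suc m) p g ≡ true →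
  ∀ b → 2 ≤ b → b ≤ X → ¬ p ^ suc m ∣ b ^ (p ∸ 1) ∸ 1
largeRoots-sound X m (suc (suc zero)) g pr (s≤s (s≤s ())) eq
largeRoots-sound X m p@(suc (suc n@(suc _))) g pr _ eq b@(suc b′) 2≤b b≤X N∣
  with largeRootsMod-sound {p ^ suc m} {X} {n} {g} eq
... | ω , large , ω-root = go (root-pigeonhole m pr u u-root)
  where
  N = p ^ suc m
  u : Fin p → ℕ
  u zero    = b
  u (suc j) = ω ^ toℕ j
  b-root : Root p N b
  b-root = ∣∸1⇒Cong (m^n>0 b (suc n)) N∣
  ω^-root : ∀ k → Root p N (ω ^ k)
  ω^-root k = Cong-trans (Cong-reflexive (trans (^-*-assoc ω k (suc n))
    (trans (cong (ω ^_) (*-comm k (suc n))) (sym (^-*-assoc ω (suc n) k))))) (1^ k)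
    where
    1^ : ∀ k → Cong N ((ω ^ suc n) ^ k) 1
    1^ zero    = Cong-reflexive refl
    1^ (suc k) = Cong-trans (Cong-* ω-root (1^ k)) (Cong-reflexive refl)
  u-root : ∀ i → Root p N (u i)
  u-root zero    = b-root
  u-root (suc j) = ω^-root (toℕ j)
  X<N : X < N
  X<N with large {0} (s≤s z≤n)
  ... | v , v<N , X<v , _ = <-trans X<v v<N
  -- As y ≤ X < N, y is its own residue, whereas the residue of ω^(i+1) exceeds X.
  residue≡⇒⊥ : ∀ {i y} → i < n → Cong N y (ω ^ suc i) → y ≤ X → ⊥
  residue≡⇒⊥ i<n y≡ y≤X with large i<n
  ... | v , v<N , X<v , v≡ = <⇒≱ X<v (subst (_≤ X)
          (Cong-unique (≤-<-trans y≤X X<N) v<N (Cong-trans y≡ (Cong-sym v≡))) y≤X)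
  1≤X : 1 ≤ X
  1≤X = ≤-trans (<⇒≤ 2≤b) b≤X
  b-power : ∀ k → k ≤ n → Cong N b (ω ^ k) → ⊥
  b-power zero    _   b≡ = <⇒≢ 2≤b (sym (Cong-unique (≤-<-trans b≤X X<N) (≤-<-trans 1≤X X<N) b≡))
  b-power (suc i) i<n b≡ = residue≡⇒⊥ i<n b≡ b≤X
  -- Two equal powers make ω^(j-i) congruent to 1, and 1 ≤ X is again too small.
  equal-powers : ∀ i j → i < j → j ≤ n → Cong N (ω ^ i) (ω ^ j) → ⊥
  equal-powers i j i<j j≤n ω^≡ with m≤n⇒∃[o]m+o≡n i<j
  ... | d , refl = residue≡⇒⊥ (≤-trans (s≤s (m≤n+m d i)) j≤n)
          (Cong-sym (Cong-^-shift {N} {ω} {n} {i} (suc d) ω-root (≤-trans (<⇒≤ i<j) (≤-trans j≤n (n≤1+n n)))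
            (subst (λ k → Cong N (ω ^ i) (ω ^ k)) (sym (+-suc i d)) ω^≡))) 1≤X
  go : ¬ (∃[ i ] ∃[ j ] (toℕ i < toℕ j × Cong N (u i) (u j)))
  go (zero  , suc j , _         , b≡) = b-power (toℕ j) (≤-pred (toℕ<n j)) b≡
  go (suc i , suc j , (s≤s i<j) , ω≡) = equal-powers (toℕ i) (toℕ j) i<j (≤-pred (toℕ<n j)) ω≡

-- No q-th power lies just below (A B)^q.

*-power : ∀ m n k → (m * n) ^ k ≡ m ^ k * n ^ k
*-power m n zero    = refl
*-power m n (suc k) = trans (cong (m * n *_) (*-power m n k)) ([m*n]*[o*p]≡[m*o]*[n*p] m n (m ^ k) (n ^ k))

-- With `bernoulli-upper` this is a mean value estimate: it confines the difference of two (n+1)-th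
-- powers between multiples of the n-th powers of the bases.
bernoulli : ∀ y δ n → y ^ suc n + suc n * δ * y ^ n ≤ (y + δ) ^ suc n
bernoulli y δ zero    = ≤-reflexive (lem y δ)
  where
  lem : ∀ y δ → y * 1 + (1 * δ) * 1 ≡ (y + δ) * 1
  lem = solve-∀
bernoulli y δ (suc n) = begin
  y * (y * Y) + suc (suc n) * δ * (y * Y)              ≤⟨ m≤m+n _ (suc n * δ * δ * Y) ⟩
  y * (y * Y) + suc (suc n) * δ * (y * Y) + suc n * δ * δ * Y ≡⟨ lem y δ n Y ⟩
  (y + δ) * (y * Y + suc n * δ * Y)                    ≤⟨ *-monoʳ-≤ (y + δ) (bernoulli y δ n) ⟩
  (y + δ) * (y + δ) ^ suc n                            ∎
  where
  open ≤-Reasoning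
  Y = y ^ n
  lem : ∀ y δ n Y → y * (y * Y) + suc (suc n) * δ * (y * Y) + suc n * δ * δ * Y
                  ≡ (y + δ) * (y * Y + suc n * δ * Y)
  lem = solve-∀

bernoulli-upper : ∀ y δ n → (y + δ) ^ suc n ≤ y ^ suc n + suc n * δ * (y + δ) ^ n
bernoulli-upper y δ zero    = ≤-reflexive (lem y δ)
  where
  lem : ∀ y δ → (y + δ) * 1 ≡ y * 1 + (1 * δ) * 1
  lem = solve-∀
bernoulli-upper y δ (suc n) = begin
  (y + δ) * S                                  ≡⟨ *-distribʳ-+ S y δ ⟩
  y * S + δ * S                                ≤⟨ +-monoˡ-≤ (δ * S) (*-monoʳ-≤ y (bernoulli-upper y δ n)) ⟩
  y * (y ^ suc n + suc n * δ * (y + δ) ^ n) + δ * S ≤⟨ m≤m+n _ (δ * (suc n * δ * (y + δ) ^ n)) ⟩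
  y * (y ^ suc n + suc n * δ * (y + δ) ^ n) + δ * S + δ * (suc n * δ * (y + δ) ^ n)
                                               ≡⟨ lem y δ n (y ^ suc n) ((y + δ) ^ n) ⟩
  y * y ^ suc n + suc (suc n) * δ * S          ∎
  where
  open ≤-Reasoning
  S = (y + δ) ^ suc n
  lem : ∀ y δ n Y Z → y * (Y + suc n * δ * Z) + δ * ((y + δ) * Z) + δ * (suc n * δ * Z)
                    ≡ y * Y + suc (suc n) * δ * ((y + δ) * Z)
  lem = solve-∀

n<2^n : ∀ n → n < 2 ^ n
n<2^n zero    = s≤s z≤n
n<2^n (suc n) = begin-strict
  suc n          ≤⟨ n<2^n n ⟩
  2 ^ n          <⟨ m<m+n (2 ^ n) (m^n>0 2 n) ⟩
  2 ^ n + 2 ^ n  ≡⟨ cong (2 ^ n +_) (+-identityʳ (2 ^ n)) ⟨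
  2 ^ suc n      ∎
  where open ≤-Reasoning

-- In use A = 2^n and B = b^n. With M = A^q, Q = B^q, N = AB and d = N - y, the equation (M - 1)(Q -
-- 1) = y^q says that N^q - y^q is E = M + Q - 1. The contradiction comes from estimating d in terms
-- of E.
module _ (s A B y δ M′ Q′ : ℕ)
         (4≤A : 4 ≤ A) (A<B : A < B)
         (M≡ : A ^ (3 + s) ≡ suc M′) (Q≡ : B ^ (3 + s) ≡ suc Q′)
         (B<M : B < suc M′) (N≡ : y + suc δ ≡ A * B) (y^q≡ : M′ * Q′ ≡ y ^ (3 + s)) where

  private
    r q M Q N E d : ℕ
    r = 2 + s
    q = 3 + s
    M = suc M′
    Q = suc Q′
    N = A * B
    E = Q + M′
    d = suc δ

    open ≤-Reasoning

    instance
      A≢0 : NonZero A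
      A≢0 = >-nonZero (≤-trans (s≤s z≤n) 4≤A)
      B≢0 : NonZero B
      B≢0 = >-nonZero (≤-trans (s≤s z≤n) A<B)

    N^q≡ : N ^ q ≡ M * Q
    N^q≡ = trans (*-power A B q) (cong₂ _*_ M≡ Q≡)

    N^q≡y^q+E : N ^ q ≡ y ^ q + E
    N^q≡y^q+E = trans N^q≡ (trans (lem M′ Q′) (cong (_+ E) y^q≡))
      where
      lem : ∀ m k → suc m * suc k ≡ m * k + (suc k + m)
      lem = solve-∀

    lower : q * d * y ^ r ≤ E
    lower = +-cancelˡ-≤ (y ^ q) _ _ (begin
      y ^ q + q * d * y ^ r ≤⟨ bernoulli y d r ⟩
      (y + d) ^ q           ≡⟨ cong (_^ q) N≡ ⟩
      N ^ q                 ≡⟨ N^q≡y^q+E ⟩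
      y ^ q + E             ∎)

    upper : E ≤ q * d * N ^ r
    upper = +-cancelˡ-≤ (y ^ q) _ _ (begin
      y ^ q + E                       ≡⟨ N^q≡y^q+E ⟨
      N ^ q                           ≡⟨ cong (_^ q) N≡ ⟨
      (y + d) ^ q                     ≤⟨ bernoulli-upper y d r ⟩
      y ^ q + q * d * (y + d) ^ r     ≡⟨ cong (λ x → y ^ q + q * d * x ^ r) N≡ ⟩
      y ^ q + q * d * N ^ r           ∎)

    -- Multiplying `lower` by y and putting y = N - d removes all powers of y.
    gap : q * d * (M * Q) ≤ N * E + r * d * E
    gap = begin
      q * d * (M * Q)               ≡⟨ cong (q * d *_) (trans (sym N^q≡) N^q≡y^q+E) ⟩
      q * d * (y ^ q + E)           ≡⟨ lem r d y (y ^ r) E ⟩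
      y * (q * d * y ^ r) + q * d * E ≤⟨ +-monoˡ-≤ (q * d * E) (*-monoʳ-≤ y lower) ⟩
      y * E + q * d * E             ≡⟨ lem′ r d y E ⟩
      (y + d) * E + r * d * E       ≡⟨ cong (λ n → n * E + r * d * E) N≡ ⟩
      N * E + r * d * E             ∎
      where
      lem : ∀ r d y Y E → suc r * d * (y * Y + E) ≡ y * (suc r * d * Y) + suc r * d * E
      lem = solve-∀
      lem′ : ∀ r d y E → y * E + suc r * d * E ≡ (y + d) * E + r * d * E
      lem′ = solve-∀

    -- This bounds d from below: otherwise `upper` would give E ≤ B^q = Q.
    B<qdA^r : B < q * d * A ^ r
    B<qdA^r = ≰⇒> λ le → <⇒≱ (m<m+n Q 1≤M′) (begin
      E                         ≤⟨ upper ⟩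
      q * d * N ^ r             ≡⟨ cong (q * d *_) (*-power A B r) ⟩
      q * d * (A ^ r * B ^ r)   ≡⟨ *-assoc (q * d) (A ^ r) (B ^ r) ⟨
      q * d * A ^ r * B ^ r     ≤⟨ *-monoˡ-≤ (B ^ r) le ⟩
      B ^ q                     ≡⟨ Q≡ ⟩
      Q                         ∎)
      where
      1≤M′ : 1 ≤ M′
      1≤M′ = ≤-trans (≤-trans (s≤s z≤n) A<B) (≤-pred B<M)

    2^≤A^ : ∀ n → 2 ^ n ≤ A ^ n
    2^≤A^ n = ^-monoˡ-≤ n (≤-trans (s≤s (s≤s z≤n)) 4≤A)

    M<Q : M < Q
    M<Q = subst₂ _<_ M≡ Q≡ (^-monoˡ-< q A<B)

    -- Here N < M. Since E ≤ 2Q, cancelling d and Q in `gap` leaves qM ≤ 2(N + r), which is less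
    -- than 3M.
    small-B : B < A ^ r → ⊥
    small-B B<A^r = <⇒≱ (begin-strict
      2 * (N + r)       ≡⟨ *-distribˡ-+ 2 N r ⟩
      2 * N + 2 * r     <⟨ +-mono-<-≤ (*-monoʳ-< 2 N<M) 2r≤M ⟩
      2 * M + M         ≡⟨ lem M ⟩
      3 * M             ≤⟨ *-monoˡ-≤ M (m≤m+n 3 s) ⟩
      q * M             ∎) (*-cancelʳ-≤ _ _ Q (begin
      q * M * Q         ≡⟨ *-assoc q M Q ⟩
      q * (M * Q)       ≤⟨ *-cancelʳ-≤ _ _ d (begin
        q * (M * Q) * d         ≡⟨ swap q (M * Q) d ⟩
        q * d * (M * Q)         ≤⟨ gap ⟩
        N * E + r * d * E       ≤⟨ +-monoˡ-≤ (r * d * E) (m≤m*n (N * E) d) ⟩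
        N * E * d + r * d * E   ≡⟨ gather N r d E ⟩
        (N + r) * E * d         ∎) ⟩
      (N + r) * E       ≤⟨ *-monoʳ-≤ (N + r) (+-monoʳ-≤ Q (≤-trans (n≤1+n M′) (<⇒≤ M<Q))) ⟩
      (N + r) * (Q + Q) ≡⟨ double (N + r) Q ⟩
      2 * (N + r) * Q   ∎))
      where
      N<M : N < M
      N<M = subst (N <_) M≡ (*-monoʳ-< A B<A^r)
      2r≤M : 2 * r ≤ M
      2r≤M = ≤-trans (*-monoʳ-≤ 2 (<⇒≤ (n<2^n r))) (subst (2 ^ q ≤_) M≡ (2^≤A^ q))
      lem : ∀ M → 2 * M + M ≡ 3 * M
      lem = solve-∀
      swap : ∀ a b c → a * b * c ≡ a * c * b
      swap = solve-∀
      gather : ∀ N r d E → N * E * d + r * d * E ≡ (N + r) * E * d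
      gather = solve-∀
      double : ∀ x Q → x * (Q + Q) ≡ 2 * x * Q
      double = solve-∀

    -- Eliminating d between `gap` and `B<qdA^r` bounds Q by less than (q+1)BM. But Q = B B^r, and
    -- B^r ≥ A^(r²) ≥ (q+1)M.
    large-B : A ^ r ≤ B → ⊥
    large-B A^r≤B = <⇒≱ (begin-strict
      q * B * M′ + r * M′     ≤⟨ +-monoʳ-≤ (q * B * M′) (*-monoˡ-≤ M′ r≤B) ⟩
      q * B * M′ + B * M′     ≡⟨ lem q B M′ ⟩
      suc q * B * M′          <⟨ *-monoʳ-< (suc q * B) {{m*n≢0 (suc q) B}} (n<1+n M′) ⟩
      suc q * B * M           ≡⟨ lem′ (suc q) B M ⟩
      B * (suc q * M)         ≤⟨ *-monoʳ-≤ B dominated ⟩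
      B * B ^ r               ≡⟨ Q≡ ⟩
      Q                       ∎) Q≤
      where
      r≤B : r ≤ B
      r≤B = ≤-trans (≤-trans (<⇒≤ (n<2^n r)) (2^≤A^ r)) A^r≤B
      lem : ∀ q B m → q * B * m + B * m ≡ suc q * B * m
      lem = solve-∀
      lem′ : ∀ q B m → q * B * m ≡ B * (q * m)
      lem′ = solve-∀
      4+s≤ : 4 + s ≤ A ^ suc s
      4+s≤ = begin
        4 + s         ≤⟨ +-monoʳ-≤ 4 (m≤n*m s 4) ⟩
        4 + 4 * s     ≡⟨ *-suc 4 s ⟨
        4 * suc s     ≤⟨ *-mono-≤ 4≤A (≤-trans (n<2^n s) (2^≤A^ s)) ⟩
        A * A ^ s     ∎
      dominated : suc q * M ≤ B ^ r
      dominated = begin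
        suc q * M              ≤⟨ *-monoˡ-≤ M 4+s≤ ⟩
        A ^ suc s * M          ≡⟨ cong (A ^ suc s *_) M≡ ⟨
        A ^ suc s * A ^ q      ≡⟨ ^-distribˡ-+-* A (suc s) q ⟨
        A ^ (suc s + q)        ≤⟨ ^-monoʳ-≤ A (≤-trans (m≤m+n (suc s + q) (s * r)) (≤-reflexive (square s))) ⟩
        A ^ (r * r)            ≡⟨ ^-*-assoc A r r ⟨
        (A ^ r) ^ r            ≤⟨ ^-monoˡ-≤ r A^r≤B ⟩
        B ^ r                  ∎
        where
        square : ∀ s → suc s + (3 + s) + s * (2 + s) ≡ (2 + s) * (2 + s)
        square = solve-∀
      D : ℕ
      D = q * (M * Q) ∸ r * E
      -- The subtraction in D does not truncate, because r ≤ q and E ≤ N^q = MQ.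
      D+rE≡ : D + r * E ≡ q * (M * Q)
      D+rE≡ = m∸n+n≡m (*-mono-≤ (n≤1+n r) (subst (E ≤_) (trans (sym N^q≡y^q+E) N^q≡) (m≤n+m E (y ^ q))))
      dD≤NE : d * D ≤ N * E
      dD≤NE = +-cancelʳ-≤ (r * d * E) _ _ (begin
        d * D + r * d * E   ≡⟨ fold d D r E ⟩
        d * (D + r * E)     ≡⟨ cong (d *_) D+rE≡ ⟩
        d * (q * (M * Q))   ≡⟨ fold′ d q (M * Q) ⟩
        q * d * (M * Q)     ≤⟨ gap ⟩
        N * E + r * d * E   ∎)
        where
        fold : ∀ d D r E → d * D + r * d * E ≡ d * (D + r * E)
        fold = solve-∀
        fold′ : ∀ d q x → d * (q * x) ≡ q * d * x
        fold′ = solve-∀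
      combined : suc B * D ≤ q * M * B * E
      combined = begin
        suc B * D                 ≤⟨ *-monoˡ-≤ D B<qdA^r ⟩
        q * d * A ^ r * D         ≡⟨ arrange q d (A ^ r) D ⟩
        q * A ^ r * (d * D)       ≤⟨ *-monoʳ-≤ (q * A ^ r) dD≤NE ⟩
        q * A ^ r * (A * B * E)   ≡⟨ arrange′ q (A ^ r) A B E ⟩
        q * A ^ q * B * E         ≡⟨ cong (λ m → q * m * B * E) M≡ ⟩
        q * M * B * E             ∎
        where
        arrange : ∀ q d a D → q * d * a * D ≡ q * a * (d * D)
        arrange = solve-∀
        arrange′ : ∀ q a A B E → q * a * (A * B * E) ≡ q * (A * a) * B * E
        arrange′ = solve-∀
      -- Replacing B + 1 by M in the term with rE, by `B<M`, puts a factor M everywhere, and it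
      -- cancels.
      Q≤ : Q ≤ q * B * M′ + r * M′
      Q≤ = +-cancelʳ-≤ (r * Q) _ _ (*-cancelˡ-≤ M (+-cancelˡ-≤ (q * M * B * Q) _ _ (begin
        q * M * B * Q + M * (Q + r * Q)                  ≡⟨ a₁ r M B Q ⟩
        suc B * (q * (M * Q))                            ≡⟨ cong (suc B *_) D+rE≡ ⟨
        suc B * (D + r * E)                              ≡⟨ *-distribˡ-+ (suc B) D (r * E) ⟩
        suc B * D + suc B * (r * E)                      ≤⟨ +-mono-≤ combined (*-monoˡ-≤ (r * E) B<M) ⟩
        q * M * B * (Q + M′) + M * (r * (Q + M′))        ≡⟨ a₂ q r M B Q M′ ⟩
        q * M * B * Q + M * (q * B * M′ + r * M′ + r * Q) ∎)))
        where
        a₁ : ∀ r M B Q → suc r * M * B * Q + M * (Q + r * Q) ≡ suc B * (suc r * (M * Q))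
        a₁ = solve-∀
        a₂ : ∀ q r M B Q m → q * M * B * (Q + m) + M * (r * (Q + m))
                           ≡ q * M * B * Q + M * (q * B * m + r * m + r * Q)
        a₂ = solve-∀

  no-nearby-power : ⊥
  no-nearby-power with B <? A ^ r
  ... | yes B<A^r = small-B B<A^r
  ... | no  B≮A^r = large-B (≮⇒≥ B≮A^r)

-- Bounds for the valuations of 2^(p-1) - 1 and b^(p-1) - 1.

DepthBound : (p b D : ℕ) → Set
DepthBound p b D = ∀ i j → p ^ i ∣ 2 ^ (p ∸ 1) ∸ 1 → p ^ j ∣ b ^ (p ∸ 1) ∸ 1 → i + j ≤ D

largeRoots-depth : ∀ X m p g → Prime p → 3 ≤ p → largeRoots X (suc m) p g ≡ true →
  ∀ {b j} → 2 ≤ b → b ≤ X → p ^ j ∣ b ^ (p ∸ 1) ∸ 1 → j ≤ m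
largeRoots-depth X m p g pr 3≤p eq {b} 2≤b b≤X d = ≮⇒≥ λ m<j →
  largeRoots-sound X m p g pr 3≤p eq b 2≤b b≤X (∣-trans (^-monoʳ-∣ p m<j) d)

properFactor : (n d : ℕ) → Bool
properFactor n d@(suc (suc _)) = (d <ᵇ n) ∧ (n % d ≡ᵇ 0)
properFactor n _               = false

-- As 41² > 1415, every composite number below 1415 that enters the table has a proper factor in
-- this list.
smallPrimes : List ℕ
smallPrimes = 2 ∷ 3 ∷ 5 ∷ 7 ∷ 11 ∷ 13 ∷ 17 ∷ 19 ∷ 23 ∷ 29 ∷ 31 ∷ 37 ∷ []

hasSmallFactor : ℕ → Bool
hasSmallFactor n = any (properFactor n) smallPrimes

-- Every prime below 1415 has a primitive root in this list.
generators : List ℕ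
generators = 2 ∷ 3 ∷ 5 ∷ 6 ∷ 7 ∷ 10 ∷ 11 ∷ 13 ∷ 14 ∷ 15 ∷ 17 ∷ 19 ∷ 21 ∷ []

-- The exponent 13 is the least one for which 3^13 exceeds 10^6; at p = 3 the root -1 passes the
-- check only then.
tableEntry : ℕ → Bool
tableEntry n = hasSmallFactor n ∨ any (largeRoots (10 ^ 6) 13 n) generators

table : all tableEntry (applyUpTo (3 +_) 1412) ≡ true
table = refl

∨-true : ∀ {a b} → a ∨ b ≡ true → a ≡ true ⊎ b ≡ true
∨-true {true}  eq = inj₁ eq
∨-true {false} eq = inj₂ eq

any-true : ∀ {f : ℕ → Bool} xs → any f xs ≡ true → ∃[ x ] f x ≡ true
any-true {f} (x ∷ xs) eq with f x in fx
... | true  = x , fx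
... | false = any-true xs eq

all-applyUpTo : ∀ {f : ℕ → Bool} h n → all f (applyUpTo h n) ≡ true → ∀ {i} → i < n → f (h i) ≡ true
all-applyUpTo h (suc n) eq {zero}  _         = proj₁ (∧-true eq)
all-applyUpTo h (suc n) eq {suc i} (s≤s i<n) = all-applyUpTo (λ i → h (suc i)) n (proj₂ (∧-true eq)) i<n

prime-properFactor : ∀ {p d} → Prime p → properFactor p d ≡ true → ⊥
prime-properFactor {p} {d@(suc (suc _))} pr eq with ∧-true {d <ᵇ p} eq
... | d<p , d∣p with prime⇒irreducible pr (m%n≡0⇒n∣m p d (≡ᵇ-true d∣p))
...   | inj₂ d≡p = <⇒≢ (<ᵇ-true d<p) d≡p

tableEntry-prime : ∀ {p} → Prime p → tableEntry p ≡ true → ∃[ g ] largeRoots (10 ^ 6) 13 p g ≡ true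
tableEntry-prime {p} pr eq with ∨-true {hasSmallFactor p} {any (largeRoots (10 ^ 6) 13 p) generators} eq
... | inj₁ small = let d , d-factor = any-true {properFactor p} smallPrimes small
                   in ⊥-elim (prime-properFactor {d = d} pr d-factor)
... | inj₂ large = any-true {largeRoots (10 ^ 6) 13 p} generators large

tableEntry-true : ∀ {n} → 3 ≤ n → n < 1415 → tableEntry n ≡ true
tableEntry-true 3≤n n<1415 = subst (λ n → tableEntry n ≡ true) (m+[n∸m]≡n 3≤n)
  (all-applyUpTo {tableEntry} (3 +_) 1412 table (∸-monoˡ-< n<1415 3≤n))

-- Both bases 2 and b lie in the range of the table, and each contributes at most 12.
small-prime-depth : ∀ {p b} → Prime p → 3 ≤ p → p < 1415 → 2 ≤ b → b ≤ 10 ^ 6 → DepthBound p b 24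
small-prime-depth {p} pr 3≤p p<1415 2≤b b≤X i j p^i∣ p^j∣ with tableEntry-prime pr (tableEntry-true 3≤p p<1415)
... | g , eq = +-mono-≤ (depth {j = i} ≤-refl (≤ᵇ⇒≤ 2 (10 ^ 6) tt) p^i∣) (depth {j = j} 2≤b b≤X p^j∣)
  where
  depth : ∀ {b j} → 2 ≤ b → b ≤ 10 ^ 6 → p ^ j ∣ b ^ (p ∸ 1) ∸ 1 → j ≤ 12
  depth {b} {j} = largeRoots-depth (10 ^ 6) 12 p g pr 3≤p eq {b} {j}

odd-prime : ∀ {p} → Prime p → 3 ≤ p → ¬ 2 ∣ p
odd-prime pr 3≤p 2∣p with prime⇒irreducible pr 2∣p
... | inj₂ 2≡p = <⇒≢ 3≤p 2≡p

odd⇒1+2* : ∀ n → ¬ 2 ∣ n → ∃[ h ] n ≡ suc (2 * h)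
odd⇒1+2* n odd with n % 2 | m≡m%n+[m/n]*n n 2 | m%n<n n 2
... | 0           | eq | _ = ⊥-elim (odd (divides (n / 2) eq))
... | 1           | eq | _ = n / 2 , trans eq (cong suc (*-comm (n / 2) 2))
... | suc (suc _) | _  | s≤s (s≤s ())

∸1-factorise : ∀ {x k} h → suc (suc k) ≡ x ^ h → x ^ (2 * h) ∸ 1 ≡ suc k * (3 + k)
∸1-factorise {x} {k} h eq = cong (_∸ 1) (trans (cong (x ^_) (*-comm 2 h))
  (trans (sym (^-*-assoc x h 2)) (trans (cong (_^ 2) (sym eq)) (lem k))))
  where
  lem : ∀ k → (2 + k) * ((2 + k) * 1) ≡ 1 + suc k * (3 + k)
  lem = solve-∀

-- p divides at most one of xʰ - 1 and xʰ + 1.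
half-order-bound : ∀ {p x} → Prime p → 3 ≤ p → 2 ≤ x → ∀ h i → 1 ≤ h →
  p ^ i ∣ x ^ (2 * h) ∸ 1 → p ^ i ≤ x ^ h + 1
half-order-bound {p} {x} pr 3≤p 2≤x h i 1≤h d with m≤n⇒∃[o]m+o≡n 1<x^h
  where
  1<x^h : 2 ≤ x ^ h
  1<x^h = ≤-trans 2≤x (subst (_≤ x ^ h) (*-identityʳ x)
    (^-monoʳ-≤ x {{>-nonZero (<⇒≤ 2≤x)}} 1≤h))
... | k , eq with p ∣? suc k
...   | no p∤ = subst (λ y → p ^ i ≤ y + 1) eq (subst (p ^ i ≤_) (+-comm 1 (2 + k))
        (∣⇒≤ (^-coprime-cancel-∣ i pr p∤ (subst (p ^ i ∣_) (∸1-factorise h eq) d))))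
...   | yes p∣ = subst (λ y → p ^ i ≤ y + 1) eq (≤-trans
        (∣⇒≤ (^-coprime-cancel-∣ i pr p∤ (subst (p ^ i ∣_)
          (trans (∸1-factorise h eq) (*-comm (suc k) (3 + k))) d)))
        (m≤n⇒m≤n+o 1 (n≤1+n (suc k))))
  where
  p∤ : ¬ p ∣ 3 + k
  p∤ d = <⇒≱ 3≤p (∣⇒≤ (∣m+n∣m⇒∣n (subst (p ∣_) (+-comm 2 (suc k)) d) p∣))

-- With p = 2h + 1, a sum i + j ≥ p would give p^p ≤ (2^h + 1)(b^h + 1) ≤ 4(2b)^h ≤ 4p^(2h) < p^p.
-- The threshold 1415 is the least integer whose square reaches 2 * 10^6.
large-prime-depth : ∀ {p b} → Prime p → 1415 ≤ p → 2 ≤ b → b ≤ 10 ^ 6 → DepthBound p b (p ∸ 1)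
large-prime-depth {p} {b} pr p≥ 2≤b b≤X i j p^i∣ p^j∣
  with odd⇒1+2* p (odd-prime pr (≤-trans (≤ᵇ⇒≤ 3 1415 tt) p≥))
... | h , refl = ≮⇒≥ λ lt → <-irrefl refl (begin-strict
  p ^ p                               ≤⟨ ^-monoʳ-≤ p lt ⟩
  p ^ (i + j)                         ≡⟨ ^-distribˡ-+-* p i j ⟩
  p ^ i * p ^ j                       ≤⟨ *-mono-≤ (half-order-bound pr 3≤p ≤-refl h i 1≤h p^i∣)
                                                 (half-order-bound pr 3≤p 2≤b h j 1≤h p^j∣) ⟩
  (2 ^ h + 1) * (b ^ h + 1)           ≤⟨ *-mono-≤ (+-monoʳ-≤ (2 ^ h) (m^n>0 2 h))
                                                 (+-monoʳ-≤ (b ^ h) (m^n>0 b {{>-nonZero (<⇒≤ 2≤b)}} h)) ⟩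
  (2 ^ h + 2 ^ h) * (b ^ h + b ^ h)   ≡⟨ lem (2 ^ h) (b ^ h) ⟩
  4 * (2 ^ h * b ^ h)                 ≡⟨ cong (4 *_) (*-power 2 b h) ⟨
  4 * (2 * b) ^ h                     ≤⟨ *-monoʳ-≤ 4 (^-monoˡ-≤ h 2b≤) ⟩
  4 * (p ^ 2) ^ h                     <⟨ *-monoˡ-< ((p ^ 2) ^ h) {{m^n≢0 (p ^ 2) h {{m^n≢0 p 2}}}} 4<p ⟩
  p * (p ^ 2) ^ h                     ≡⟨ cong (p *_) (^-*-assoc p 2 h) ⟩
  p ^ p                               ∎)
  where
  open ≤-Reasoning
  3≤p : 3 ≤ p
  3≤p = ≤-trans (≤ᵇ⇒≤ 3 1415 tt) p≥
  4<p : 4 < p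
  4<p = ≤-trans (≤ᵇ⇒≤ 5 1415 tt) p≥
  1≤h : 1 ≤ h
  1≤h = *-cancelˡ-< 2 0 h (≤-pred (≤-trans (s≤s (s≤s z≤n)) 3≤p))
  2b≤ : 2 * b ≤ p ^ 2
  2b≤ = ≤-trans (*-monoʳ-≤ 2 b≤X) (≤-trans (≤ᵇ⇒≤ (2 * 10 ^ 6) (1415 ^ 2) tt) (^-monoˡ-≤ 2 p≥))
  lem : ∀ a b → (a + a) * (b + b) ≡ 4 * (a * b)
  lem = solve-∀

-- Valuations of x^k - 1.

suc-pred-^ : ∀ x n → 1 ≤ x → suc (x ^ n ∸ 1) ≡ x ^ n
suc-pred-^ x n 1≤x = m+[n∸m]≡n (m^n>0 x {{>-nonZero 1≤x}} n)

prime∤power∸1 : ∀ {p x n} → Prime p → 1 ≤ x → p ∣ x → 1 ≤ n → ¬ p ∣ x ^ n ∸ 1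
prime∤power∸1 {p} {x} {suc n} pr 1≤x p∣x _ d = prime∤1 pr (∣m+n∣m⇒∣n
  (subst (p ∣_) (trans (sym (suc-pred-^ x (suc n) 1≤x)) (+-comm 1 (x ^ suc n ∸ 1))) (∣m⇒∣m*n (x ^ n) p∣x)) d)

-- By Fermat r divides x^(r-1) - 1, so the exponent c can be lifted from the base x^(r-1).
val-power∸1 : ∀ {r x c v} → Prime r → 3 ≤ r → 2 ≤ x → ¬ r ∣ x → Val r c v →
  ∃[ α ] (1 ≤ α × r ^ α ∣ x ^ (r ∸ 1) ∸ 1 × Val r (x ^ (c * (r ∸ 1)) ∸ 1) (α + v))
val-power∸1 {r} {x} {c} {v} pr 3≤r 2≤x r∤x vc with val-exists pr (x ^ (r ∸ 1) ∸ 1) 1≤z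
  where
  1≤r∸1 : 1 ≤ r ∸ 1
  1≤r∸1 = ∸-monoˡ-≤ 1 (≤-trans (n≤1+n 2) 3≤r)
  1≤z : 1 ≤ x ^ (r ∸ 1) ∸ 1
  1≤z = ∸-monoˡ-≤ 1 (≤-trans 2≤x (subst (_≤ x ^ (r ∸ 1)) (*-identityʳ x)
    (^-monoʳ-≤ x {{>-nonZero (<⇒≤ 2≤x)}} 1≤r∸1)))
... | α , vα = α , val-max pr vα (subst (_∣ x ^ (r ∸ 1) ∸ 1) (sym (*-identityʳ r)) (fermat-∣ pr r∤x)) ,
      val-∣ vα ≤-refl ,
      subst (λ y → Val r (y ∸ 1) (α + v)) power≡
        (lifting-the-exponent pr (odd-liftable pr (>⇒∤ 3≤r) (fermat-∣ pr r∤x)) vα vc)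
  where
  power≡ : suc (x ^ (r ∸ 1) ∸ 1) ^ c ≡ x ^ (c * (r ∸ 1))
  power≡ = trans (cong (_^ c) (suc-pred-^ x (r ∸ 1) (<⇒≤ 2≤x)))
    (trans (^-*-assoc x (r ∸ 1) c) (cong (x ^_) (*-comm (r ∸ 1) c)))

val-2 : Val 2 2 1
val-2 = val 1 refl (prime∤1 prime[2])

-- One of c and 1 + c is odd, so one of the factors 2c and 2(1 + c) has valuation 1.
val-b²∸1 : ∀ {c f E} → 1 ≤ c → ¬ 2 ^ f ∣ 2 * c → ¬ 2 ^ f ∣ 2 * (1 + c) →
  Val 2 (2 * c * (2 * (1 + c))) E → E ≤ f
val-b²∸1 {c} {f} {E} 1≤c f∤ f∤′ vE
  with val-exists prime[2] c 1≤c | val-exists prime[2] (suc c) (s≤s z≤n)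
... | d , vd | e , ve with 2 ∣? c
...   | no 2∤c = subst (_≤ f)
          (val-unique prime[2] (val-* prime[2] (val-* prime[2] val-2 (val-0 2∤c)) two-suc-c) vE)
          (≰⇒> λ f≤ → f∤′ (val-∣ two-suc-c f≤))
  where
  two-suc-c : Val 2 (2 * (1 + c)) (1 + e)
  two-suc-c = val-* prime[2] val-2 ve
...   | yes 2∣c = subst (_≤ f)
          (trans (+-comm 1 (1 + d)) (val-unique prime[2]
            (val-* prime[2] two-c (val-* prime[2] val-2 (val-0 (2∤1+c)))) vE))
          (≰⇒> λ f≤ → f∤ (val-∣ two-c f≤))
  where
  two-c : Val 2 (2 * c) (1 + d)
  two-c = val-* prime[2] val-2 vd
  2∤1+c : ¬ 2 ∣ 1 + c
  2∤1+c d = prime∤1 prime[2] (∣m+n∣m⇒∣n (subst (2 ∣_) (+-comm 1 c) d) 2∣c)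

coprime-*-∣ : ∀ {p k} e {u} → Prime p → ¬ p ∣ u → p ^ e ∣ k → u ∣ k → p ^ e * u ∣ k
coprime-*-∣ {p} e {u} pr p∤u p^e∣k (divides c refl) =
  *-monoˡ-∣ u (^-coprime-cancel-∣ e pr p∤u (subst (p ^ e ∣_) (*-comm c u) p^e∣k))

prime-divisor : ∀ n → 2 ≤ n → ∃[ p ] (Prime p × p ∣ n)
prime-divisor n 2≤n with factorise n {{>-nonZero (<⇒≤ 2≤n)}}
... | record { factors = []     ; isFactorisation = refl } = ⊥-elim (<-irrefl refl 2≤n)
... | record { factors = p ∷ ps ; isFactorisation = refl ; factorsPrime = pr ∷ _ } = p , pr , m∣m*n _

-- Divisors of k forced or excluded by a solution.

module Equation {b q k y : ℕ} (odd-b : Odd b) (3≤b : 3 ≤ b) (q-prime : Prime q) (3≤q : 3 ≤ q)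
         (b<2^q : b < 2 ^ q) (1≤k : 1 ≤ k) (1≤y : 1 ≤ y) (solution : Solution b q k y) where

  private
    1≤b : 1 ≤ b
    1≤b = ≤-trans (s≤s z≤n) 3≤b

    q∣val : ∀ {p e} → Prime p → Val p ((2 ^ k ∸ 1) * (b ^ k ∸ 1)) e → 1 ≤ e → q ≤ e
    q∣val {e = suc _} pr v _ = ∣⇒≤ (val-power pr 1≤y (subst (λ n → Val _ n _) solution v))

    q≤val₂ : ∀ {e} → Val 2 (b ^ k ∸ 1) e → 1 ≤ e → q ≤ e
    q≤val₂ v = q∣val prime[2] (val-* prime[2] (val-0 (prime∤power∸1 prime[2] (s≤s z≤n) ∣-refl 1≤k)) v)

    half : ∃[ c ] b ≡ suc (2 * c)
    half = odd⇒1+2* b odd-b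

  -- For odd k the valuation of b^k - 1 at 2 is that of b - 1. It would be at least q, so 2^q ≤ b -
  -- 1.
  k-even : 2 ∣ k
  k-even with half
  ... | c , refl with 2 ∣? k
  ...   | yes 2∣k = 2∣k
  ...   | no  2∤k with val-exists prime[2] (2 * c) (≤-pred (≤-trans (n≤1+n 2) 3≤b))
  ...     | e , v = ⊥-elim (<⇒≱ b<2^q (≤-trans
            (∣⇒≤ {{>-nonZero (≤-pred (≤-trans (n≤1+n 2) 3≤b))}} (val-∣ v
              (q≤val₂ (val-coprime-power prime[2] (m∣m*n c) 2∤k v)
                (val-max prime[2] v (m∣m*n c)))))
            (n≤1+n (2 * c))))

  -- For k = 2k′ the valuation of b^k - 1 at 2 is that of b² - 1, at most f, plus that of k′. As the
  -- sum is at least q, k has valuation at least q + 1 - f = j.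
  two-adic : ∀ f j → suc q ≡ f + j → ¬ 2 ^ f ∣ b ∸ 1 → ¬ 2 ^ f ∣ b + 1 → 2 ^ j ∣ k
  two-adic f j 1+q≡ f∤b∸1 f∤b+1 with half | k-even
  ... | c , refl | divides k′ refl with val-exists prime[2] z 1≤z | val-exists prime[2] k′ 1≤k′
    where
    z = 2 * c * (2 * (1 + c))
    1≤2c : 1 ≤ 2 * c
    1≤2c = ≤-pred (≤-trans (n≤1+n 2) 3≤b)
    1≤z : 1 ≤ z
    1≤z = *-mono-≤ 1≤2c (s≤s z≤n)
    1≤k′ : 1 ≤ k′
    1≤k′ = *-cancelʳ-< 2 0 k′ 1≤k
  ...   | E , vE | v , vk′ = ∣-trans (^-monoʳ-∣ 2 j≤) (val-∣ (val-* prime[2] vk′ val-2) ≤-refl)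
    where
    z = 2 * c * (2 * (1 + c))
    square : ∀ c → suc (2 * c * (2 * (1 + c))) ≡ suc (2 * c) * (suc (2 * c) * 1)
    square = solve-∀
    1≤2c : 1 ≤ 2 * c
    1≤2c = ≤-pred (≤-trans (n≤1+n 2) 3≤b)
    vb : Val 2 (suc (2 * c) ^ (k′ * 2) ∸ 1) (E + v)
    vb = subst (λ n → Val 2 (n ∸ 1) (E + v))
      (trans (cong (_^ k′) (square c)) (trans (^-*-assoc (suc (2 * c)) 2 k′) (cong (suc (2 * c) ^_) (*-comm 2 k′))))
      -- The base is b² and not b, because `Liftable` at 2 asks for 4 ∣ z and b may be 3 modulo 4.
      (lifting-the-exponent prime[2] (∣m⇒∣m*n (2 * (1 + c)) (m∣m*n c) ,
        subst (4 ∣_) (sym (*-identityˡ z)) (*-pres-∣ (m∣m*n {2} c) (m∣m*n {2} (1 + c)))) vE vk′)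
    1≤E : 1 ≤ E
    1≤E = val-max prime[2] vE (∣m⇒∣m*n (2 * (1 + c)) (m∣m*n c))
    E≤f : E ≤ f
    E≤f = val-b²∸1 {c} {f} (*-cancelˡ-< 2 0 c 1≤2c) f∤b∸1 (subst (λ n → ¬ 2 ^ f ∣ n) (two c) f∤b+1) vE
      where
      two : ∀ c → suc (2 * c) + 1 ≡ 2 * (1 + c)
      two = solve-∀
    j≤ : j ≤ v + 1
    j≤ = +-cancelˡ-≤ f _ _ (begin
      f + j            ≡⟨ 1+q≡ ⟨
      suc q            ≤⟨ s≤s (q≤val₂ vb (m≤n⇒m≤n+o v 1≤E)) ⟩
      suc (E + v)      ≡⟨ +-comm 1 (E + v) ⟩
      E + v + 1        ≡⟨ +-assoc E v 1 ⟩
      E + (v + 1)      ≤⟨ +-monoˡ-≤ (v + 1) E≤f ⟩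
      f + (v + 1)      ∎)
      where open ≤-Reasoning

  -- For k = c(r - 1) and v the valuation of c at r, that of the product is positive by Fermat for
  -- the base 2, hence at least q, and it is at most D + 2v. If v < L, then D + 2v + 2 ≤ q + 1,
  -- which is absurd.
  odd-adic : ∀ {r} D L → Prime r → 3 ≤ r → r ∸ 1 ∣ k →
    DepthBound r b D → D + 2 * L ≤ suc q → r ^ L ∣ k
  odd-adic {r} D L pr 3≤r (divides c refl) depth D+2L≤ with val-exists pr c (1≤c c 1≤k)
    where
    1≤c : ∀ c → 1 ≤ c * (r ∸ 1) → 1 ≤ c
    1≤c (suc c) _ = s≤s z≤n
  ... | v , vc with L ≤? v
  ...   | yes L≤v = ∣m⇒∣m*n (r ∸ 1) (val-∣ vc L≤v)
  ...   | no  L≰v = ⊥-elim (q≰ (by-cases (r ∣? b)))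
    where
    by-cases : Dec (r ∣ b) → q ≤ D + 2 * v
    by-cases r∣b? with val-power∸1 pr 3≤r ≤-refl (>⇒∤ 3≤r) vc | r∣b?
    ... | α , 1≤α , r^α∣ , vα | yes r∣b = begin
      q                 ≤⟨ q∣val pr (val-* pr vα (val-0 (prime∤power∸1 pr 1≤b r∣b 1≤k)))
                             (≤-trans 1≤α (≤-trans (m≤m+n α v) (m≤m+n (α + v) 0))) ⟩
      α + v + 0         ≡⟨ lem α v ⟩
      -- When r ∣ b, the factor b^k - 1 contributes nothing, so `depth` is taken at j = 0.
      α + 0 + v         ≤⟨ +-mono-≤ (depth α 0 r^α∣ (1∣ _)) (m≤m+n v (v + 0)) ⟩
      D + 2 * v         ∎
      where
      open ≤-Reasoning
      lem : ∀ α v → α + v + 0 ≡ α + 0 + v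
      lem = solve-∀
    ... | α , 1≤α , r^α∣ , vα | no r∤b with val-power∸1 pr 3≤r (≤-trans (n≤1+n 2) 3≤b) r∤b vc
    ...   | β , _ , r^β∣ , vβ = begin
      q                 ≤⟨ q∣val pr (val-* pr vα vβ)
                             (≤-trans 1≤α (≤-trans (m≤m+n α v) (m≤m+n (α + v) (β + v)))) ⟩
      α + v + (β + v)   ≡⟨ lem α v β ⟩
      α + β + 2 * v     ≤⟨ +-monoˡ-≤ (2 * v) (depth α β r^α∣ r^β∣) ⟩
      D + 2 * v         ∎
      where
      open ≤-Reasoning
      lem : ∀ α v β → α + v + (β + v) ≡ α + β + 2 * v
      lem = solve-∀
    q≰ : ¬ q ≤ D + 2 * v
    q≰ q≤ = <-irrefl refl (begin-strict
      suc q             ≤⟨ s≤s q≤ ⟩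
      1 + (D + 2 * v)   <⟨ n<1+n (1 + (D + 2 * v)) ⟩
      2 + (D + 2 * v)   ≡⟨ lem D v ⟩
      D + 2 * suc v     ≤⟨ +-monoʳ-≤ D (*-monoʳ-≤ 2 (≰⇒> L≰v)) ⟩
      D + 2 * L         ≤⟨ D+2L≤ ⟩
      suc q             ∎)
      where
      open ≤-Reasoning
      lem : ∀ D v → 2 + (D + 2 * v) ≡ D + 2 * suc v
      lem = solve-∀

  -- If k = nq, then n is even because k is even and q odd; hence 2^n ≥ 4. From b < 2^q comes b^n <
  -- 2^k, the hypothesis B < M of `no-nearby-power`.
  q∤k : ¬ q ∣ k
  q∤k (divides n refl) with m≤n⇒∃[o]m+o≡n 3≤q
  ... | s , refl with m≤n⇒∃[o]m+o≡n y<AB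
    where
    y<AB : y < 2 ^ n * b ^ n
    y<AB = ≰⇒> λ AB≤y → <-irrefl refl (begin-strict
      y ^ q                                   ≡⟨ solution ⟨
      (2 ^ k ∸ 1) * (b ^ k ∸ 1)               <⟨ *-mono-< (pred-< 2 (s≤s z≤n)) (pred-< b 1≤b) ⟩
      2 ^ k * b ^ k                           ≡⟨ cong₂ _*_ (^-*-assoc 2 n q) (^-*-assoc b n q) ⟨
      (2 ^ n) ^ q * (b ^ n) ^ q               ≡⟨ *-power (2 ^ n) (b ^ n) q ⟨
      (2 ^ n * b ^ n) ^ q                     ≤⟨ ^-monoˡ-≤ q AB≤y ⟩
      y ^ q                                   ∎)
      where
      open ≤-Reasoning
      pred-< : ∀ x → 1 ≤ x → x ^ k ∸ 1 < x ^ k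
      pred-< x 1≤x = ≤-reflexive (suc-pred-^ x k 1≤x)
  ...   | δ , N≡ = no-nearby-power s (2 ^ n) (b ^ n) y δ (2 ^ k ∸ 1) (b ^ k ∸ 1)
            (^-monoʳ-≤ 2 2≤n) (^-monoˡ-< n {{>-nonZero (<⇒≤ 2≤n)}} 3≤b)
            (trans (^-*-assoc 2 n q) (sym (suc-pred-^ 2 k (s≤s z≤n))))
            (trans (^-*-assoc b n q) (sym (suc-pred-^ b k 1≤b)))
            (subst (b ^ n <_)
              (trans (^-*-assoc 2 q n) (trans (cong (2 ^_) (*-comm q n)) (sym (suc-pred-^ 2 k (s≤s z≤n)))))
              (^-monoˡ-< n {{>-nonZero (<⇒≤ 2≤n)}} b<2^q))
            (trans (+-suc y δ) N≡) solution
    where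
    even-factor : ∀ n → 2 ∣ n * q → 1 ≤ n * q → 2 ≤ n
    even-factor n@(suc _) 2∣k _ with euclidsLemma n q prime[2] 2∣k
    ... | inj₁ 2∣n = ∣⇒≤ 2∣n
    ... | inj₂ 2∣q = ⊥-elim (odd-prime q-prime 3≤q 2∣q)
    2≤n : 2 ≤ n
    2≤n = even-factor n k-even 1≤k

-- Exponents q ≥ 29.

n+19≤2^n : ∀ n → 5 ≤ n → n + 19 ≤ 2 ^ n
n+19≤2^n n 5≤n with m≤n⇒∃[o]m+o≡n 5≤n
... | t , refl = begin
  5 + t + 19        ≡⟨ +-comm (5 + t) 19 ⟩
  24 + t            ≤⟨ +-mono-≤ (≤ᵇ⇒≤ 24 32 tt) (m≤n*m t 32) ⟩
  32 + 32 * t       ≡⟨ *-suc 32 t ⟨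
  32 * suc t        ≤⟨ *-monoʳ-≤ 32 (n<2^n t) ⟩
  32 * 2 ^ t        ≡⟨ ^-distribˡ-+-* 2 5 t ⟨
  2 ^ (5 + t)       ∎
  where open ≤-Reasoning

2^e≤q⇒e+19≤q : ∀ {e q} → 29 ≤ q → 2 ^ e ≤ q → e + 19 ≤ q
2^e≤q⇒e+19≤q {e} 29≤q 2^e≤q with e ≤? 10
... | yes e≤10 = ≤-trans (+-monoˡ-≤ 19 e≤10) 29≤q
... | no  e≰10 = ≤-trans (n+19≤2^n e (≤-trans (≤ᵇ⇒≤ 5 11 tt) (≰⇒> e≰10))) 2^e≤q

-- This is the room `odd-adic` needs with D = 24. For e = 3 and q = 29 it is an equality, so the
-- threshold 29 is used in full.
3^e≤q⇒24+2e≤1+q : ∀ {e q} → 29 ≤ q → 3 ^ e ≤ q → 24 + 2 * e ≤ suc q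
3^e≤q⇒24+2e≤1+q {e} {q} 29≤q 3^e≤q with 4 ≤? e
... | no  4≰e = ≤-trans (+-monoʳ-≤ 24 (*-monoʳ-≤ 2 (≤-pred (≰⇒> 4≰e)))) (s≤s 29≤q)
... | yes 4≤e with m≤n⇒∃[o]m+o≡n 4≤e
...   | t , refl = begin
  24 + 2 * (4 + t)  ≡⟨ lem t ⟩
  32 + 2 * t        ≤⟨ +-mono-≤ (≤ᵇ⇒≤ 32 81 tt) (*-monoˡ-≤ t (≤ᵇ⇒≤ 2 81 tt)) ⟩
  81 + 81 * t       ≡⟨ *-suc 81 t ⟨
  81 * suc t        ≤⟨ *-monoʳ-≤ 81 (≤-trans (n<2^n t) (^-monoˡ-≤ t (n≤1+n 2))) ⟩
  81 * 3 ^ t        ≡⟨ ^-distribˡ-+-* 3 4 t ⟨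
  3 ^ (4 + t)       ≤⟨ 3^e≤q ⟩
  q                 ≤⟨ n≤1+n q ⟩
  suc q             ∎
  where
  open ≤-Reasoning
  lem : ∀ t → 24 + 2 * (4 + t) ≡ 32 + 2 * t
  lem = solve-∀

-- For r^e ≤ q this yields the room `odd-adic` needs with D = r - 1.
r+2e≤r^e+2 : ∀ {r e} → 1 ≤ e → 2 ≤ r → r + 2 * e ≤ r ^ e + 2
r+2e≤r^e+2 {r} {suc zero}    _ 2≤r = +-monoˡ-≤ 2 (≤-reflexive (sym (*-identityʳ r)))
r+2e≤r^e+2 {r} {suc (suc e)} _ 2≤r = begin
  r + 2 * suc (suc e)           ≡⟨ lem r e ⟩
  2 + (r + 2 * suc e)           ≤⟨ +-mono-≤ 2≤r^ (r+2e≤r^e+2 {r} {suc e} (s≤s z≤n) 2≤r) ⟩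
  r ^ suc e + (r ^ suc e + 2)   ≡⟨ lem′ (r ^ suc e) ⟩
  2 * r ^ suc e + 2             ≤⟨ +-monoˡ-≤ 2 (*-monoˡ-≤ (r ^ suc e) 2≤r) ⟩
  r ^ suc (suc e) + 2           ∎
  where
  open ≤-Reasoning
  2≤r^ : 2 ≤ r ^ suc e
  2≤r^ = *-mono-≤ 2≤r (m^n>0 r {{>-nonZero (<⇒≤ 2≤r)}} e)
  lem : ∀ r e → r + 2 * suc (suc e) ≡ 2 + (r + 2 * suc e)
  lem = solve-∀
  lem′ : ∀ x → x + (x + 2) ≡ 2 * x + 2
  lem′ = solve-∀

module _ {b q k y : ℕ} (odd-b : Odd b) (3≤b : 3 ≤ b) (q-prime : Prime q) (3≤q : 3 ≤ q)
         (b<2^q : b < 2 ^ q) (1≤k : 1 ≤ k) (1≤y : 1 ≤ y) (solution : Solution b q k y) where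

  open Equation {b} {q} {k} {y} odd-b 3≤b q-prime 3≤q b<2^q 1≤k 1≤y solution

  -- Let r be a prime divisor of n = r^e u with u prime to r. Both u and r - 1 are below n, so they
  -- divide k by induction, and r - 1 ∣ k is what `odd-adic` requires.
  all-divide : b ≤ 10 ^ 6 → 29 ≤ q → ∀ n → 1 ≤ n → n ≤ q → n ∣ k
  all-divide b≤X 29≤q = <-rec _ step
    where
    step : ∀ n → (∀ {m} → m < n → 1 ≤ m → m ≤ q → m ∣ k) → 1 ≤ n → n ≤ q → n ∣ k
    step (suc zero)        rec _   _   = 1∣ k
    step n@(suc (suc _)) rec 1≤n n≤q with prime-divisor n (s≤s (s≤s z≤n))
    ... | r , pr , r∣n with val-exists pr n 1≤n
    ...   | e , v@(val u n≡ r∤u) = subst (_∣ k) (sym n≡)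
            (coprime-*-∣ e pr r∤u (r^e∣k (r ≟ 2)) (u∣k u n≡))
      where
      r^e≤q : r ^ e ≤ q
      r^e≤q = ≤-trans (∣⇒≤ (val-∣ v ≤-refl)) n≤q
      1≤e : 1 ≤ e
      1≤e = val-max pr v (subst (_∣ n) (sym (*-identityʳ r)) r∣n)
      2≤r^e : 2 ≤ r ^ e
      2≤r^e = ≤-trans (subst (2 ≤_) (sym (*-identityʳ r)) (prime>1 pr))
        (^-monoʳ-≤ r {{prime⇒nonZero pr}} 1≤e)
      u∣k : ∀ u → n ≡ r ^ e * u → u ∣ k
      u∣k zero    n≡ = ⊥-elim (<⇒≢ 1≤n (sym (trans n≡ (*-zeroʳ (r ^ e)))))
      u∣k u@(suc _) n≡ = rec u<n (s≤s z≤n) (≤-trans (<⇒≤ u<n) n≤q)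
        where
        u<n : u < n
        u<n = subst (u <_) (trans (*-comm u (r ^ e)) (sym n≡)) (m<m*n u (r ^ e) 2≤r^e)
      r^e∣k : Dec (r ≡ 2) → r ^ e ∣ k
      r^e∣k (yes refl) = two-adic f e (sym (m∸n+n≡m e≤1+q))
        (>⇒∤ {{>-nonZero (∸-monoˡ-≤ {2} 1 (≤-trans (n≤1+n 2) 3≤b))}}
          (≤-trans (s≤s (≤-trans (m∸n≤m b 1) (m≤m+n b 1))) b+1<))
        (>⇒∤ {{>-nonZero (m≤n+m 1 b)}} b+1<)
        where
        -- Here f ≥ 20, so 2^f exceeds 10^6 + 1 ≥ b + 1 and divides neither of the positive numbers
        -- b - 1 and b + 1.
        f = suc q ∸ e
        20+e≤1+q : 20 + e ≤ suc q
        20+e≤1+q = s≤s (subst (_≤ q) (+-comm e 19) (2^e≤q⇒e+19≤q 29≤q r^e≤q))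
        e≤1+q : e ≤ suc q
        e≤1+q = ≤-trans (m≤n+m e 20) 20+e≤1+q
        b+1< : b + 1 < 2 ^ f
        b+1< = ≤-trans (s≤s (+-monoˡ-≤ 1 b≤X)) (≤-trans (≤ᵇ⇒≤ (10 ^ 6 + 2) (2 ^ 20) tt)
          (^-monoʳ-≤ 2 (m+n≤o⇒m≤o∸n 20 20+e≤1+q)))
      r^e∣k (no r≢2) = odd-case (r <? 1415)
        where
        3≤r : 3 ≤ r
        3≤r = ≤∧≢⇒< (prime>1 pr) (λ eq → r≢2 (sym eq))
        r∸1<n : r ∸ 1 < n
        r∸1<n = ≤-trans (≤-reflexive (m+[n∸m]≡n (≤-trans (s≤s z≤n) 3≤r))) (∣⇒≤ r∣n)
        r∸1∣k : r ∸ 1 ∣ k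
        r∸1∣k = rec r∸1<n (∸-monoˡ-≤ 1 (≤-trans (n≤1+n 2) 3≤r)) (≤-trans (<⇒≤ r∸1<n) n≤q)
        odd-case : Dec (r < 1415) → r ^ e ∣ k
        odd-case (yes r<1415) = odd-adic 24 e pr 3≤r r∸1∣k
          (small-prime-depth pr 3≤r r<1415 (≤-trans (n≤1+n 2) 3≤b) b≤X)
          (3^e≤q⇒24+2e≤1+q {e} 29≤q (≤-trans (^-monoˡ-≤ e 3≤r) r^e≤q))
        odd-case (no r≮1415) = odd-adic (r ∸ 1) e pr 3≤r r∸1∣k
          (large-prime-depth pr (≮⇒≥ r≮1415) (≤-trans (n≤1+n 2) 3≤b) b≤X)
          (+-cancelˡ-≤ 1 _ _ (begin
            1 + (r ∸ 1 + 2 * e)   ≡⟨ +-assoc 1 (r ∸ 1) (2 * e) ⟨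
            1 + (r ∸ 1) + 2 * e   ≡⟨ cong (_+ 2 * e) (m+[n∸m]≡n (≤-trans (s≤s z≤n) 3≤r)) ⟩
            r + 2 * e             ≤⟨ r+2e≤r^e+2 {r} {e} 1≤e (prime>1 pr) ⟩
            r ^ e + 2             ≤⟨ +-monoˡ-≤ 2 r^e≤q ⟩
            q + 2                 ≡⟨ +-comm q 2 ⟩
            1 + suc q             ∎))
          where open ≤-Reasoning

  no-large-exponent : b ≤ 10 ^ 6 → 29 ≤ q → ⊥
  no-large-exponent b≤X 29≤q = q∤k (all-divide b≤X 29≤q q (≤-trans (s≤s z≤n) 3≤q) ≤-refl)

  -- The check with X = 2 modulo r² says that r is not a Wieferich prime, so the base 2 contributes
  -- only 1 and D is 1 + m. A smaller X than 10^6 allows a smaller m.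
  checked-adic : ∀ r X m g L → Prime r → 3 ≤ r → b ≤ X →
    largeRoots 2 2 r g ≡ true → largeRoots X (suc m) r g ≡ true →
    r ∸ 1 ∣ k → 1 + m + 2 * L ≤ suc q → r ^ L ∣ k
  checked-adic r X m g L pr 3≤r b≤X check₂ check r∸1∣k bound = odd-adic (1 + m) L pr 3≤r r∸1∣k
    (λ i j r^i∣ r^j∣ → +-mono-≤ (largeRoots-depth 2 1 r g pr 3≤r check₂ {2} {i} ≤-refl ≤-refl r^i∣)
      (largeRoots-depth X m r g pr 3≤r check {b} {j} (≤-trans (n≤1+n 2) 3≤b) b≤X r^j∣)) bound

  checked-contradiction : ∀ X m g → b ≤ X → largeRoots 2 2 q g ≡ true → largeRoots X (suc m) q g ≡ true →
    q ∸ 1 ∣ k → m + 2 ≤ q → ⊥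
  checked-contradiction X m g b≤X check₂ check q∸1∣k bound = q∤k (subst (_∣ k) (*-identityʳ q)
    (checked-adic q X m g 1 q-prime 3≤q b≤X check₂ check q∸1∣k (s≤s bound)))

-- Exponents q < 29.

2-power-avoided : ∀ {b} f g → 3 ≤ b → b + 1 < 2 ^ g * 2 ^ f →
  (∀ t → 1 ≤ t → t < 2 ^ g → ¬ (b ≡ t * 2 ^ f + 1 ⊎ b ≡ t * 2 ^ f ∸ 1)) →
  ¬ 2 ^ f ∣ b ∸ 1 × ¬ 2 ^ f ∣ b + 1
2-power-avoided {b@(suc b′)} f g 3≤b b+1< avoid =
  (λ where
    (divides t eq) → avoid t (positive t eq (≤-pred (≤-trans (n≤1+n 2) 3≤b)))
      (bounded t (b ∸ 1) eq (≤-trans (n≤1+n b′) (m≤m+n b 1)))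
      (inj₁ (trans (+-comm 1 b′) (cong (_+ 1) eq)))) ,
  (λ where
    (divides t eq) → avoid t (positive t eq (m≤n+m 1 b)) (bounded t (b + 1) eq ≤-refl)
      (inj₂ (trans (sym (m+n∸n≡m b 1)) (cong (_∸ 1) eq))))
  where
  positive : ∀ t {n} → n ≡ t * 2 ^ f → 1 ≤ n → 1 ≤ t
  positive zero    refl 1≤n = 1≤n
  positive (suc t) _    _   = s≤s z≤n
  bounded : ∀ t n → n ≡ t * 2 ^ f → n ≤ b + 1 → t < 2 ^ g
  bounded t n eq n≤ = *-cancelʳ-< (2 ^ f) t (2 ^ g) (subst (_< 2 ^ g * 2 ^ f) eq (≤-<-trans n≤ b+1<))

only-1 : (P : ℕ → Set) → P 1 → ∀ t → 1 ≤ t → t < 2 → P t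
only-1 P p (suc zero)    _ _               = p
only-1 P p (suc (suc _)) _ (s≤s (s≤s ()))

oddPrimes<29 : List ℕ
oddPrimes<29 = 3 ∷ 5 ∷ 7 ∷ 11 ∷ 13 ∷ 17 ∷ 19 ∷ 23 ∷ []

prime∈oddPrimes<29 : ∀ {q} → Prime q → 3 ≤ q → q < 29 → q ∈ oddPrimes<29
prime∈oddPrimes<29 {q} pr 3≤q q<29 with from-yes (allUpTo?
  (λ n → (3 ≤? n) →-dec ((hasSmallFactor n Bool.≟ true) ⊎-dec (n ∈? oddPrimes<29))) 29) q<29 3≤q
... | inj₂ q∈ = q∈
... | inj₁ small = let d , d-factor = any-true {properFactor q} smallPrimes small
                   in ⊥-elim (prime-properFactor {d = d} pr d-factor)

-- Each case aims at q - 1 ∣ k, whereupon `check-q` contradicts `q∤k`. Its numbers are X, m and a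
-- primitive root g modulo q; `check` takes the prime r before them and L after. X is 2^q - 2 up to
-- q = 13 and 10^6 from q = 17 on.
no-small-exponent : ∀ {b q k y} → Odd b → 3 ≤ b → b ≤ 10 ^ 6 → Prime q → 3 ≤ q → q >log₂ (b + 1) →
  ¬ Exceptional b q → 1 ≤ k → 1 ≤ y → Solution b q k y → q ∈ oddPrimes<29 → ⊥
no-small-exponent {b} {q} {k} {y} odd-b 3≤b b≤X q-prime 3≤q b+1<2^q unexceptional 1≤k 1≤y solution = λ where
    (here refl) →
      check-q 6 1 2 b≤2^q∸2 refl refl k-even (≤ᵇ⇒≤ 3 3 tt)
    (there (here refl)) →
      -- The exponents satisfy 4 + 2 = q + 1. As b + 1 < 32, the only multiple of 16 to avoid is 16
      -- itself, which gives b = 15 and b = 17.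
      let 4∣k = power-of-2 4 1 2 refl b+1<2^q (only-1 _ λ where
            (inj₁ b≡17) → unexceptional (inj₁ (refl , inj₂ b≡17))
            (inj₂ b≡15) → unexceptional (inj₁ (refl , inj₁ b≡15)))
      in check-q 30 2 2 b≤2^q∸2 refl refl 4∣k (≤ᵇ⇒≤ 4 5 tt)
    (there (there (here refl))) →
      let 3∣k = check 3 126 4 2 1 prime[3] 3≤3 b≤2^q∸2 refl refl k-even (≤ᵇ⇒≤ 7 8 tt)
      in check-q 126 3 3 b≤2^q∸2 refl refl
           (coprime-*-∣ 1 prime[3] (from-no (3 ∣? 2)) 3∣k k-even) (≤ᵇ⇒≤ 5 7 tt)
    (there (there (there (here refl)))) →
      -- The goal 10 ∣ k calls for the prime 5, and `odd-adic` at 5 starts from 4 ∣ k.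
      let 4∣k = power-of-2 10 1 2 refl b+1<2^q (only-1 _ λ where
            (inj₁ b≡1025) → unexceptional (inj₂ (inj₁ (refl , inj₂ b≡1025)))
            (inj₂ b≡1023) → unexceptional (inj₂ (inj₁ (refl , inj₁ b≡1023))))
          5∣k = check 5 2046 8 2 1 prime[5] 3≤5 b≤2^q∸2 refl refl 4∣k (≤ᵇ⇒≤ 11 12 tt)
      in check-q 2046 8 2 b≤2^q∸2 refl refl
           (coprime-*-∣ 1 prime[5] (from-no (5 ∣? 2)) 5∣k k-even) (≤ᵇ⇒≤ 10 11 tt)
    (there (there (there (there (here refl))))) →
      let 4∣k = power-of-2 12 1 2 refl b+1<2^q (only-1 _ λ where
            (inj₁ b≡4097) → unexceptional (inj₂ (inj₂ (inj₁ (refl , inj₂ b≡4097))))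
            (inj₂ b≡4095) → unexceptional (inj₂ (inj₂ (inj₁ (refl , inj₁ b≡4095)))))
          3∣k = check 3 8190 10 2 1 prime[3] 3≤3 b≤2^q∸2 refl refl k-even (≤ᵇ⇒≤ 13 14 tt)
      in check-q 8190 9 2 b≤2^q∸2 refl refl
           (coprime-*-∣ 1 prime[3] (from-no (3 ∣? 4)) 3∣k 4∣k) (≤ᵇ⇒≤ 11 13 tt)
    (there (there (there (there (there (here refl)))))) →
      -- All of q - 1 = 16 has to come from the prime 2, so f is only 14, and seven multiples of
      -- 2^14 stay in reach below 2^17.
      let 16∣k = power-of-2 14 3 4 refl b+1<2^q (λ t 1≤t t<8 b≡ →
            unexceptional (inj₂ (inj₂ (inj₂ (refl , t , 1≤t , ≤-pred t<8 , b≡)))))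
      in check-q (10 ^ 6) 9 3 b≤X refl refl 16∣k (≤ᵇ⇒≤ 11 17 tt)
    (there (there (there (there (there (there (here refl))))))) →
      -- Since q - 1 = 18, the square of 3 is required, hence L = 2.
      let 9∣k = check 3 (10 ^ 6) 12 2 2 prime[3] 3≤3 b≤X refl refl k-even (≤ᵇ⇒≤ 17 20 tt)
      in check-q (10 ^ 6) 7 2 b≤X refl refl
           (coprime-*-∣ 2 prime[3] (from-no (3 ∣? 2)) 9∣k k-even) (≤ᵇ⇒≤ 9 19 tt)
    (there (there (there (there (there (there (there (here refl)))))))) →
      -- The goal 22 ∣ k calls for 11, which starts from 10 ∣ k, hence from 5 and so from 4. As 2^22
      -- > b + 1, no b has to be avoided.
      let 4∣k = power-of-2 22 0 2 refl
            (≤-trans (s≤s (+-monoˡ-≤ 1 b≤X)) (≤ᵇ⇒≤ (10 ^ 6 + 2) (2 ^ 22) tt))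
            (λ t 1≤t t<1 → ⊥-elim (<⇒≱ t<1 1≤t))
          5∣k  = check 5 (10 ^ 6) 10 2 1 prime[5] 3≤5 b≤X refl refl 4∣k (≤ᵇ⇒≤ 13 24 tt)
          10∣k = coprime-*-∣ 1 prime[5] (from-no (5 ∣? 2)) 5∣k k-even
          11∣k = check 11 (10 ^ 6) 10 2 1 (from-yes (prime? 11)) (≤ᵇ⇒≤ 3 11 tt) b≤X refl refl
            10∣k (≤ᵇ⇒≤ 13 24 tt)
      in check-q (10 ^ 6) 10 5 b≤X refl refl
           (coprime-*-∣ 1 (from-yes (prime? 11)) (from-no (11 ∣? 2)) 11∣k k-even) (≤ᵇ⇒≤ 12 23 tt)
  where
  3≤3 : 3 ≤ 3
  3≤3 = ≤-refl
  3≤5 : 3 ≤ 5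
  3≤5 = m≤m+n 3 2
  prime[5] : Prime 5
  prime[5] = from-yes (prime? 5)
  b<2^q : b < 2 ^ q
  b<2^q = ≤-<-trans (m≤m+n b 1) b+1<2^q
  b≤2^q∸2 : b ≤ 2 ^ q ∸ 2
  b≤2^q∸2 = m+n≤o⇒m≤o∸n b (subst (_≤ 2 ^ q) (lem b) b+1<2^q)
    where
    lem : ∀ b → suc (b + 1) ≡ b + 2
    lem = solve-∀
  open Equation {b} {q} {k} {y} odd-b 3≤b q-prime 3≤q b<2^q 1≤k 1≤y solution
  check-q = checked-contradiction {b} {q} {k} {y} odd-b 3≤b q-prime 3≤q b<2^q 1≤k 1≤y solution
  check = checked-adic {b} {q} {k} {y} odd-b 3≤b q-prime 3≤q b<2^q 1≤k 1≤y solution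
  prime[3] : Prime 3
  prime[3] = from-yes (prime? 3)
  power-of-2 : ∀ f g j → suc q ≡ f + j → b + 1 < 2 ^ g * 2 ^ f →
    (∀ t → 1 ≤ t → t < 2 ^ g → ¬ (b ≡ t * 2 ^ f + 1 ⊎ b ≡ t * 2 ^ f ∸ 1)) → 2 ^ j ∣ k
  power-of-2 f g j eq b+1< avoid with 2-power-avoided f g 3≤b b+1< avoid
  ... | f∤b∸1 , f∤b+1 = two-adic f j eq f∤b∸1 f∤b+1

theorem3 : (b q : ℕ) → Odd b → 3 ≤ b → b ≤ 10 ^ 6 →
    Prime q → Odd q → q >log₂ (b + 1) →
    ¬ Exceptional b q →
    ¬ (∃[ k ] ∃[ y ] (2 ≤ k × 2 ≤ y × Solution b q k y))
theorem3 b q odd-b 3≤b b≤X q-prime odd-q b+1<2^q unexceptional (k , y , 2≤k , 2≤y , solution)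
  with q <? 29
... | yes q<29 = no-small-exponent odd-b 3≤b b≤X q-prime 3≤q b+1<2^q unexceptional
        (<⇒≤ 2≤k) (<⇒≤ 2≤y) solution (prime∈oddPrimes<29 q-prime 3≤q q<29)
  where
  3≤q : 3 ≤ q
  3≤q = ≤∧≢⇒< (prime>1 q-prime) λ where refl → odd-q ∣-refl
... | no  q≮29 = no-large-exponent odd-b 3≤b q-prime (≤-trans (≤ᵇ⇒≤ 3 29 tt) (≮⇒≥ q≮29))
        (≤-<-trans (m≤m+n b 1) b+1<2^q) (<⇒≤ 2≤k) (<⇒≤ 2≤y) solution b≤X (≮⇒≥ q≮29)
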